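{- Let $d\ge 1$ be an integer and let $\mathcal{F}$ be the barycentric subdivision of $(d-1)$-dimensional simplicial complexes. Then its transformation matrix $H_{\mathcal F}$ has the bidiagonal decomposition $$H_{\mathcal F}=W_0W_1\cdots W_{d-1}W_d\cdots W_{2d-1},$$ where the $(d+1)\times(d+1)$ matrices $W_0,\dots,W_{2d-1}$ (rows and columns indexed by $0,\dots,d$) are as follows. (1) For $i=0,1,\dots,d-1$, $W_i$ is lower bidiagonal with - diagonal entries $W_i(m,m)=m+1$ for $0\le m\le d-i-1$ and $W_i(m,m)=1$ for $d-i\le m\le d$; - subdiagonal entries $W_i(m,m-1)=d-i-m$ for $1\le m\le d-i-1$ and $W_i(m,m-1)=0$ for $d-i\le m\le d$; - all other entries $0$. (2) For $j=0,1,\dots,d-1$, $W_{d+j}$ is upper bidiagonal with - diagonal entries $W_{d+j}(m,m)=1$ for $0\le m\le d$; - superdiagonal entries $W_{d+j}(m-1,m)=0$ for $1\le m\le j$ and $W_{d+j}(m-1,m)=\frac{m-j-1}{m-j}$ for $j+1\le m\le d$; - all other entries $0$.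
   Context: Rows and columns of matrices are indexed starting from $0$. All simplicial complexes are finite. For a $(d-1)$-dimensional simplicial complex $\Delta$ with $f_{i-1}$ faces of dimension $i-1$ ($f_{ -1}=1$), the $h$-vector $h^\Delta=(h_0,\dots,h_d)$ is defined by $\sum_{i=0}^d h_i x^i=\sum_{i=0}^d f_{i-1}x^i(1-x)^{d-i}$. The barycentric subdivision of $\Delta$ is the simplicial complex of all chains in the poset of nonempty faces of $\Delta$ ordered by inclusion. Its transformation matrix $H_{\mathcal{F}}$ is the $(d+1)\times(d+1)$ matrix, depending only on $d$, such that $h^{\Delta'}=H_{\mathcal{F}}\,h^{\Delta}$ (column vectors) for every $(d-1)$-dimensional simplicial complex $\Delta$ with barycentric subdivision $\Delta'$. Explicitly (a known result of Brenti and Welker), $$H_{\mathcal F}=\left[\sum_{r=0}^{i} r^j (r+1)^{d-j}(-1)^{i-r}\binom{d+1}{i-r}\right]_{0\le i,j\le d},$$ with the convention $0^0=1$. -}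

module Defs where

open import Level using (0ℓ)
open import Data.Bool.Base using (if_then_else_)
open import Data.Fin.Base using (Fin; toℕ)
open import Data.Fin.Properties using (all?)
open import Data.Fin.Subset using (Subset; inside; outside; _∈_; _⊆_; ∣_∣; Nonempty) renaming (⊥ to ∅)
open import Data.Fin.Subset.Properties using (_∈?_; _⊆?_; nonempty?; ∉⊥)
open import Data.Integer.Base using (+_)
open import Data.List.Base using (List; []; _∷_; _++_; map; filter; length; lookup; foldr; upTo)
open import Data.Nat.Base using (ℕ; zero; suc; _∸_; _≤_; _<ᵇ_; _≡ᵇ_)
import Data.Nat.Properties as ℕ
open import Data.Product.Base using (Σ-syntax; _×_)
open import Data.Rational.Base using (ℚ; 0ℚ; 1ℚ; _+_; _-_; _*_; _/_)
open import Data.Rational.Properties using (+-0-commutativeMonoid)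
open import Algebra.Properties.CommutativeMonoid.Sum +-0-commutativeMonoid using (sum)
import Data.Vec.Base as Vec
open import Relation.Binary.PropositionalEquality using (_≡_)
open import Relation.Nullary.Decidable using (_×-dec_; _⊎-dec_; _→-dec_)
open import Relation.Nullary.Negation using (contradiction)
open import Data.Sum.Base using (_⊎_)
open import Relation.Unary using (Pred; Decidable)

------------------------------------------------------------------------
-- Simplicial complexes

-- A finite simplicial complex on the ground set Fin size.  Elements of
-- the ground set are not required to be vertices, so every finite
-- complex occurs up to isomorphism; the empty face is always present.
record Complex : Set₁ where
  field
    size   : ℕ
    Face   : Pred (Subset size) 0ℓ
    face?  : Decidable Face
    ∅-face : Face ∅
    down   : ∀ {S T} → S ⊆ T → Face T → Face S

open Complex public

-- Every subset of Fin n, each listed once.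
subsets : ∀ n → List (Subset n)
subsets zero    = Vec.[] ∷ []
subsets (suc n) = map (inside Vec.∷_) (subsets n) ++ map (outside Vec.∷_) (subsets n)

-- The number of faces with exactly i elements: f_{i-1} in the usual
-- indexing by dimension, so that faceCount Δ 0 = f₋₁ = 1.
faceCount : Complex → ℕ → ℕ
faceCount Δ i =
  length (filter (λ S → face? Δ S ×-dec (∣ S ∣ ℕ.≟ i)) (subsets (size Δ)))

-- Δ has dimension d - 1, i.e. its largest faces have exactly d elements.
HasDim[_-1] : ℕ → Complex → Set
HasDim[ d -1] Δ =
  (Σ[ S ∈ Subset (size Δ) ] Face Δ S × ∣ S ∣ ≡ d) × (∀ S → Face Δ S → ∣ S ∣ ≤ d)

nonemptyFaces : (Δ : Complex) → List (Subset (size Δ))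
nonemptyFaces Δ = filter (λ S → face? Δ S ×-dec nonempty? S) (subsets (size Δ))

-- The order complex of the poset of nonempty faces.  The vertex k of the
-- subdivision stands for the k-th entry of nonemptyFaces Δ.
barycentric : Complex → Complex
barycentric Δ = record
  { size   = length (nonemptyFaces Δ)
  ; Face   = IsChain
  ; face?  = λ C → all? λ k → all? λ l →
               (k ∈? C) →-dec ((l ∈? C) →-dec ((F k ⊆? F l) ⊎-dec (F l ⊆? F k)))
  ; ∅-face = λ k l k∈∅ _ → contradiction k∈∅ ∉⊥
  ; down   = λ C⊆D chain k l k∈C l∈C → chain k l (C⊆D k∈C) (C⊆D l∈C)
  }
  where
  F = lookup (nonemptyFaces Δ)

  IsChain : Pred (Subset (length (nonemptyFaces Δ))) 0ℓ
  IsChain C = ∀ k l → k ∈ C → l ∈ C → F k ⊆ F l ⊎ F l ⊆ F k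

------------------------------------------------------------------------
-- h-vectors

fromℕ : ℕ → ℚ
fromℕ n = + n / 1

-- A polynomial in x, given by its sequence of coefficients.
Poly : Set
Poly = ℕ → ℚ

one : Poly
one zero    = 1ℚ
one (suc _) = 0ℚ

x· : Poly → Poly
x· p zero    = 0ℚ
x· p (suc k) = p k

[1-x]· : Poly → Poly
[1-x]· p k = p k - x· p k

-- xᵃ (1 - x)ᵇ
xᵃ[1-x]ᵇ : ℕ → ℕ → Poly
xᵃ[1-x]ᵇ (suc a) b       = x· (xᵃ[1-x]ᵇ a b)
xᵃ[1-x]ᵇ zero    (suc b) = [1-x]· (xᵃ[1-x]ᵇ zero b)
xᵃ[1-x]ᵇ zero    zero    = one

-- Σ_{i=0}^{d} f_{i-1} xⁱ (1 - x)ᵈ⁻ⁱ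
hPoly : ℕ → Complex → Poly
hPoly d Δ k =
  sum {suc d} λ i → fromℕ (faceCount Δ (toℕ i)) * xᵃ[1-x]ᵇ (toℕ i) (d ∸ toℕ i) k

-- Every summand of hPoly d Δ has degree d, so h₀, …, h_d are all its
-- coefficients.
hVector : ∀ d → Complex → Fin (suc d) → ℚ
hVector d Δ k = hPoly d Δ (toℕ k)

------------------------------------------------------------------------
-- Matrices

Matrix : ℕ → Set
Matrix n = Fin n → Fin n → ℚ

infixl 7 _⊗_
infixr 7 _⊗ᵥ_

_⊗_ : ∀ {n} → Matrix n → Matrix n → Matrix n
(A ⊗ B) r c = sum λ k → A r k * B k c

_⊗ᵥ_ : ∀ {n} → Matrix n → (Fin n → ℚ) → (Fin n → ℚ)
(A ⊗ᵥ v) r = sum λ k → A r k * v k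

identity : ∀ {n} → Matrix n
identity r c = if toℕ r ≡ᵇ toℕ c then 1ℚ else 0ℚ

-- The product of a list of matrices, in the order of the list.
product : ∀ {n} → List (Matrix n) → Matrix n
product = foldr _⊗_ identity

-- H is the transformation matrix of the barycentric subdivision of
-- (d - 1)-dimensional complexes: one matrix serving all of them.
IsTransformationMatrix : ∀ d → Matrix (suc d) → Set₁
IsTransformationMatrix d H =
  ∀ (Δ : Complex) → HasDim[ d -1] Δ →
  ∀ k → hVector d (barycentric Δ) k ≡ (H ⊗ᵥ hVector d Δ) k

------------------------------------------------------------------------
-- The bidiagonal factors

-- Wᵢ(m,m) for 0 ≤ i ≤ d - 1
lowerDiag : (d i m : ℕ) → ℚ
lowerDiag d i m = if m <ᵇ d ∸ i then fromℕ (suc m) else 1ℚ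

-- Wᵢ(m,m-1) for 0 ≤ i ≤ d - 1; the subtraction is not truncated, since
-- it is only used when m < d - i.
lowerSub : (d i m : ℕ) → ℚ
lowerSub d i m = if m <ᵇ d ∸ i then fromℕ (d ∸ i ∸ m) else 0ℚ

-- W_{d+j}(m-1,m).  Here m ∸ j is zero exactly when m ≤ j, and for
-- m ≥ j + 1 it is suc k with k = m - j - 1.
upperSuper : (j m : ℕ) → ℚ
upperSuper j m with m ∸ j
... | zero  = 0ℚ
... | suc k = + k / suc k

-- Wᵢ for 0 ≤ i ≤ d - 1
lower : ∀ d → ℕ → Matrix (suc d)
lower d i r c =
  if toℕ r ≡ᵇ toℕ c then lowerDiag d i (toℕ r)
  else if toℕ r ≡ᵇ suc (toℕ c) then lowerSub d i (toℕ r)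
  else 0ℚ

-- W_{d+j} for 0 ≤ j ≤ d - 1
upper : ∀ d → ℕ → Matrix (suc d)
upper d j r c =
  if toℕ r ≡ᵇ toℕ c then 1ℚ
  else if suc (toℕ r) ≡ᵇ toℕ c then upperSuper j (toℕ c)
  else 0ℚ

W : ∀ d → ℕ → Matrix (suc d)
W d k = if k <ᵇ d then lower d k else upper d (k ∸ d)

{-# OPTIONS --safe #-}

-- For a natural number r, let h be paired with the row vectors
--   E_m(r) = C(r + d - m, d)  and  B_m(r) = (1 + r)^(d-m) r^m.
-- If h is the h-vector of a complex with face numbers f, then
-- Σ h_m E_m(r) = Σ f_{i-1} C(r, i) and Σ h_m B_m(r) = Σ f_{i-1} r^i.
-- Applied to the subdivision, the first sum counts chains of nonempty faces
-- with weight C(r, length); removing the largest face with Pascal's rule gives,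
-- by induction on r, Σ_S r^|S| over the faces S of the complex.  Hence
-- Σ h'_m E_m(r) = Σ h_m B_m(r).  On the other hand E W₀ ⋯ W_{2d-1} = B, the
-- intermediate row vectors being (1 + r)^i C(r + d - i - m, d - i) for m ≤ d - i,
-- (1 + r)^(d-m) C(r, m) for m ≥ d - i, and then (1 + r)^(d-m) C(r, m - j) r^j for
-- m ≥ j, (1 + r)^(d-m) r^m for m ≤ j.  As E_m(r) is unitriangular in (r, m), the
-- product is a transformation matrix; it is the only one because the h-vectors of
-- (d - 1)-dimensional complexes span.

module Submission where

open import Defs
open import Algebra.Bundles using (CommutativeRing)
open import Data.Bool.Base using (Bool; true; false; T; _∧_; if_then_else_)
open import Data.Bool.Properties using (T-∧; T?; ∧-assoc; ∧-idem; ∧-identityʳ; ∧-zeroʳ; if-eta; if-∧)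
open import Data.Fin.Base using (Fin; zero; suc; toℕ; inject₁) renaming (fromℕ to fromℕᶠ; _<_ to _<ᶠ_)
open import Data.Fin.Properties using (toℕ<n; toℕ≤pred[n]; toℕ-inject₁; toℕ-fromℕ)
open import Data.Fin.Subset using (Subset; inside; outside; _∈_; _∉_; _⊆_; ∣_∣; Nonempty; ⊤) renaming (⊥ to ∅)
open import Data.Fin.Subset.Properties using
  (_∈?_; _⊆?_; _⊂?_; nonempty?; ⊆-refl; ⊆-trans; ⊥⊆; ∉⊥; drop-∷-⊆; ∣⊥∣≡0; ∣⊤∣≡n; ∣p∣≤n; p⊆q⇒∣p∣≤∣q∣; p⊂q⇒∣p∣<∣q∣)
import Data.Integer.Base as ℤ
import Data.Integer.Properties as ℤ
open import Data.List.Base using (List; []; _∷_; _++_; map; upTo; applyUpTo; filter; length; lookup)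
open import Data.List.Membership.Propositional using (lose) renaming (_∈_ to _∈ₗ_)
open import Data.List.Membership.Propositional.Properties using (∈-lookup; ∈-++⁺ˡ; ∈-++⁺ʳ; ∈-map⁺; ∈-filter⁺)
open import Data.List.Properties using
  (map-upTo; map-cong; map-++; map-∘; filter-≐; filter-reject; filter-notAll; filter-some)
open import Data.List.Relation.Unary.All as All using (All; []; _∷_)
import Data.List.Relation.Unary.All.Properties as All⁺
open import Data.List.Relation.Unary.AllPairs as AllPairs using (AllPairs; []; _∷_)
import Data.List.Relation.Unary.AllPairs.Properties as AllPairs⁺
open import Data.List.Relation.Unary.Any using (here)
open import Data.Nat.Base as ℕ using (ℕ; zero; suc; _∸_; _≤_; _<_; z≤n; s≤s; _⊓_; _^_; _<ᵇ_; _≡ᵇ_)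
open import Data.Nat.Combinatorics using (_C_; nCk+nC[k+1]≡[n+1]C[k+1]; k>n⇒nCk≡0; nCn≡1)
import Data.Nat.ListAction as ListAction
open import Data.Nat.ListAction.Properties using (sum-++)
import Data.Nat.Properties as ℕ
import Data.Nat.Solver as ℕSolver
open import Data.Product.Base using (_,_; _×_; proj₁; proj₂; ∃)
open import Data.Rational.Base using (ℚ; 0ℚ; 1ℚ; _+_; _-_; _*_; _/_; -_; 1/_; ≢-nonZero; toℚᵘ)
open import Data.Rational.Properties as ℚ using (toℚᵘ-injective; toℚᵘ-fromℚᵘ; toℚᵘ-homo-+; toℚᵘ-homo-*)
import Data.Rational.Solver as ℚSolver
import Data.Rational.Unnormalised.Base as ℚᵘ
import Data.Rational.Unnormalised.Properties as ℚᵘ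
open import Algebra.Properties.CommutativeMonoid.Sum ℚ.+-0-commutativeMonoid
  using (sum; sum-cong-≗; sum-replicate-zero; sum-init-last; ∑-distrib-+; ∑-comm)
open import Algebra.Properties.Semiring.Sum (CommutativeRing.semiring ℚ.+-*-commutativeRing)
  using (*-distribˡ-sum; *-distribʳ-sum)
open import Data.Sum.Base as Sum using (_⊎_; inj₁; inj₂)
open import Data.Vec.Base using ([]; _∷_; here; there)
open import Function.Base using (_∘_; case_of_)
open import Function.Bundles using (_⇔_; mk⇔; Equivalence)
open import Level using (0ℓ)
open import Relation.Binary.PropositionalEquality using
  (_≡_; _≢_; refl; sym; trans; cong; cong₂; subst; module ≡-Reasoning)
open import Relation.Nullary.Decidable using
  (Dec; yes; no; does; dec-true; dec-false; does-⇔; decidable-stable; _×-dec_; _⊎-dec_; ¬?)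
open import Relation.Nullary.Negation using (¬_; contradiction)
open import Relation.Unary using (Pred; Decidable)

open Equivalence using (to; from)
open ≡-Reasoning

-- Embedding of the natural numbers into the rationals

fromℕ-/1 : ∀ n → toℚᵘ (fromℕ n) ℚᵘ.≃ ℚᵘ.mkℚᵘ (ℤ.+ n) 0
fromℕ-/1 n = toℚᵘ-fromℚᵘ (ℚᵘ.mkℚᵘ (ℤ.+ n) 0)

-- Normalisation by a gcd keeps `fromℕ n` from computing at a variable `n`, so the equation is
-- checked on unnormalised fractions with denominator one.
fromℕ-+ : ∀ m n → fromℕ (m ℕ.+ n) ≡ fromℕ m + fromℕ n
fromℕ-+ m n = toℚᵘ-injective (ℚᵘ.≃-trans (fromℕ-/1 (m ℕ.+ n)) (ℚᵘ.≃-trans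
  (ℚᵘ.*≡* (cong (ℤ._* ℤ.+ 1) (trans (ℤ.pos-+ m n) (sym (cong₂ ℤ._+_ (ℤ.*-identityʳ (ℤ.+ m)) (ℤ.*-identityʳ (ℤ.+ n)))))))
  (ℚᵘ.≃-trans (ℚᵘ.+-cong (ℚᵘ.≃-sym (fromℕ-/1 m)) (ℚᵘ.≃-sym (fromℕ-/1 n)))
    (ℚᵘ.≃-sym (toℚᵘ-homo-+ (fromℕ m) (fromℕ n))))))

fromℕ-* : ∀ m n → fromℕ (m ℕ.* n) ≡ fromℕ m * fromℕ n
fromℕ-* m n = toℚᵘ-injective (ℚᵘ.≃-trans (fromℕ-/1 (m ℕ.* n)) (ℚᵘ.≃-trans
  (ℚᵘ.*≡* (cong (ℤ._* ℤ.+ 1) (ℤ.pos-* m n)))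
  (ℚᵘ.≃-trans (ℚᵘ.*-cong (ℚᵘ.≃-sym (fromℕ-/1 m)) (ℚᵘ.≃-sym (fromℕ-/1 n)))
    (ℚᵘ.≃-sym (toℚᵘ-homo-* (fromℕ m) (fromℕ n))))))

-- Clears the denominator of a superdiagonal entry when `j` is `k`; for `j = 1` it provides an
-- inverse of `fromℕ (suc k)`.
/-*-cancel : ∀ j k → (ℤ.+ j / suc k) * fromℕ (suc k) ≡ fromℕ j
/-*-cancel j k = toℚᵘ-injective (ℚᵘ.≃-trans (toℚᵘ-homo-* (ℤ.+ j / suc k) (fromℕ (suc k)))
  (ℚᵘ.≃-trans (ℚᵘ.*-cong (toℚᵘ-fromℚᵘ (ℚᵘ.mkℚᵘ (ℤ.+ j) k)) (fromℕ-/1 (suc k)))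
  (ℚᵘ.≃-trans (ℚᵘ.*≡* (trans (ℤ.*-identityʳ _) (cong (λ z → ℤ.+ j ℤ.* ℤ.+ z) (sym (ℕ.*-identityʳ (suc k))))))
    (ℚᵘ.≃-sym (fromℕ-/1 j)))))

fromℕ-suc-cancel : ∀ k {x y} → fromℕ (suc k) * x ≡ fromℕ (suc k) * y → x ≡ y
fromℕ-suc-cancel k {x} {y} eq = trans (sym (undo x)) (trans (cong (ℤ.+ 1 / suc k *_) eq) (undo y))
  where
  undo : ∀ z → (ℤ.+ 1 / suc k) * (fromℕ (suc k) * z) ≡ z
  undo z = begin
    (ℤ.+ 1 / suc k) * (fromℕ (suc k) * z) ≡⟨ ℚ.*-assoc (ℤ.+ 1 / suc k) (fromℕ (suc k)) z ⟨
    (ℤ.+ 1 / suc k) * fromℕ (suc k) * z   ≡⟨ cong (_* z) (/-*-cancel 1 k) ⟩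
    1ℚ * z                                ≡⟨ ℚ.*-identityˡ z ⟩
    z                                     ∎

fromℕ-injective : ∀ {m n} → fromℕ m ≡ fromℕ n → m ≡ n
fromℕ-injective {m} {n} eq with ℚᵘ.≃-trans (ℚᵘ.≃-sym (fromℕ-/1 m)) (ℚᵘ.≃-trans (ℚᵘ.≃-reflexive (cong toℚᵘ eq)) (fromℕ-/1 n))
... | ℚᵘ.*≡* e = ℤ.+-injective (trans (sym (ℤ.*-identityʳ (ℤ.+ m))) (trans e (ℤ.*-identityʳ (ℤ.+ n))))

sum-zero : ∀ n {f : Fin n → ℚ} → (∀ k → f k ≡ 0ℚ) → sum f ≡ 0ℚ
sum-zero n f≗0 = trans (sum-cong-≗ f≗0) (sum-replicate-zero n)

-- Row vectors

infixl 7 _ᵥ⊗_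
_ᵥ⊗_ : ∀ {n} → (Fin n → ℚ) → Matrix n → (Fin n → ℚ)
(v ᵥ⊗ A) c = sum λ k → v k * A k c

-- Both sides are the double sum of `u i * A i j * v j`, taken in the two possible orders.
∑-assoc : ∀ {m n} (u : Fin m → ℚ) (A : Fin m → Fin n → ℚ) (v : Fin n → ℚ) →
          sum (λ i → u i * sum (λ j → A i j * v j)) ≡ sum (λ j → sum (λ i → u i * A i j) * v j)
∑-assoc u A v = begin
  sum (λ i → u i * sum (λ j → A i j * v j))
    ≡⟨ sum-cong-≗ (λ i → trans (*-distribˡ-sum (u i) (λ j → A i j * v j)) (sum-cong-≗ λ j → sym (ℚ.*-assoc (u i) (A i j) (v j)))) ⟩
  sum (λ i → sum (λ j → u i * A i j * v j))
    ≡⟨ ∑-comm (λ i j → u i * A i j * v j) ⟩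
  sum (λ j → sum (λ i → u i * A i j * v j))
    ≡⟨ sum-cong-≗ (λ j → sym (*-distribʳ-sum (v j) (λ i → u i * A i j))) ⟩
  sum (λ j → sum (λ i → u i * A i j) * v j) ∎

∑-unit : ∀ {n} (f : ℕ → ℚ) (c : Fin n) →
         sum {n} (λ m → f (toℕ m) * identity m c) ≡ f (toℕ c)
∑-unit {suc n} f zero = trans (cong₂ _+_ (ℚ.*-identityʳ (f 0)) (sum-zero n λ m → ℚ.*-zeroʳ (f (suc (toℕ m))))) (ℚ.+-identityʳ (f 0))
∑-unit f (suc c) = trans (cong₂ _+_ (ℚ.*-zeroʳ (f 0)) (∑-unit (f ∘ suc) c)) (ℚ.+-identityˡ _)

-- The row vector is pushed through the factors from the left, one at a time, so that no two of them
-- need to be multiplied together.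
ᵥ⊗-product : ∀ {n} (A : ℕ → Matrix n) (p : ℕ → ℕ → ℚ) ℓ →
  (∀ k → k < ℓ → ∀ c → ((λ m → p k (toℕ m)) ᵥ⊗ A k) c ≡ p (suc k) (toℕ c)) →
  ∀ c → ((λ m → p 0 (toℕ m)) ᵥ⊗ product (applyUpTo A ℓ)) c ≡ p ℓ (toℕ c)
ᵥ⊗-product A p zero    step c = ∑-unit (p 0) c
ᵥ⊗-product A p (suc ℓ) step c = begin
  sum (λ m → p 0 (toℕ m) * sum (λ k → A 0 m k * product (applyUpTo (A ∘ suc) ℓ) k c))
    ≡⟨ ∑-assoc (λ m → p 0 (toℕ m)) (A 0) _ ⟩
  sum (λ k → sum (λ m → p 0 (toℕ m) * A 0 m k) * product (applyUpTo (A ∘ suc) ℓ) k c)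
    ≡⟨ sum-cong-≗ (λ k → cong (_* product (applyUpTo (A ∘ suc) ℓ) k c) (step 0 (s≤s z≤n) k)) ⟩
  sum (λ k → p 1 (toℕ k) * product (applyUpTo (A ∘ suc) ℓ) k c)
    ≡⟨ ᵥ⊗-product (A ∘ suc) (p ∘ suc) ℓ (λ k k<ℓ → step (suc k) (s≤s k<ℓ)) c ⟩
  p (suc ℓ) (toℕ c) ∎

-- Column `c` meets only the rows `c` and `c + 1`. In the last column the second row lies outside
-- the matrix, and `β n ≡ 0ℚ` lets the same formula hold there.
∑-lowerBidiagonal : ∀ {n} (f α β : ℕ → ℚ) (c : Fin n) → β n ≡ 0ℚ →
  sum {n} (λ m → f (toℕ m) * (if toℕ m ≡ᵇ toℕ c then α (toℕ m)
                              else if toℕ m ≡ᵇ suc (toℕ c) then β (toℕ m) else 0ℚ))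
    ≡ f (toℕ c) * α (toℕ c) + f (suc (toℕ c)) * β (suc (toℕ c))
∑-lowerBidiagonal {suc zero} f α β zero βn≡0 =
  cong (f 0 * α 0 +_) (sym (trans (cong (f 1 *_) βn≡0) (ℚ.*-zeroʳ (f 1))))
∑-lowerBidiagonal {suc (suc n)} f α β zero βn≡0 =
  cong (f 0 * α 0 +_) (trans (cong (f 1 * β 1 +_) (sum-zero n λ m → ℚ.*-zeroʳ (f (suc (suc (toℕ m)))))) (ℚ.+-identityʳ _))
∑-lowerBidiagonal {suc n} f α β (suc c) βn≡0 =
  trans (cong₂ _+_ (ℚ.*-zeroʳ (f 0)) (∑-lowerBidiagonal (f ∘ suc) (α ∘ suc) (β ∘ suc) c βn≡0)) (ℚ.+-identityˡ _)

-- Column zero has no entry above the diagonal and is treated apart. In both lemmas `β` is a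
-- constant because `upper` indexes its superdiagonal by the column.
∑-upperBidiagonal-zero : ∀ n (f : ℕ → ℚ) (β : ℚ) →
  sum {suc n} (λ m → f (toℕ m) * (if toℕ m ≡ᵇ 0 then 1ℚ
                                  else if suc (toℕ m) ≡ᵇ 0 then β else 0ℚ)) ≡ f 0
∑-upperBidiagonal-zero n f β =
  trans (cong₂ _+_ (ℚ.*-identityʳ (f 0)) (sum-zero n λ m → ℚ.*-zeroʳ (f (suc (toℕ m))))) (ℚ.+-identityʳ (f 0))

∑-upperBidiagonal-suc : ∀ {n} (f : ℕ → ℚ) (β : ℚ) (c : Fin n) →
  sum {suc n} (λ m → f (toℕ m) * (if toℕ m ≡ᵇ suc (toℕ c) then 1ℚ
                                  else if suc (toℕ m) ≡ᵇ suc (toℕ c) then β else 0ℚ))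
    ≡ f (suc (toℕ c)) + f (toℕ c) * β
∑-upperBidiagonal-suc {suc n} f β zero = trans (cong (f 0 * β +_) (∑-upperBidiagonal-zero n (f ∘ suc) β)) (ℚ.+-comm (f 0 * β) (f 1))
∑-upperBidiagonal-suc f β (suc c) = trans (cong₂ _+_ (ℚ.*-zeroʳ (f 0)) (∑-upperBidiagonal-suc (f ∘ suc) β c)) (ℚ.+-identityˡ _)

-- Binomials

-- This is (k+1) C(n,k+1) = (n-k) C(n,k) with the subtracted term moved to the left, which avoids
-- truncated subtraction. Pascal's rule gives it by induction on `n`.
absorption : ∀ n k → suc k ℕ.* (n C suc k) ℕ.+ k ℕ.* (n C k) ≡ n ℕ.* (n C k)
absorption zero zero = refl
absorption zero (suc k) = begin
  suc (suc k) ℕ.* (0 C suc (suc k)) ℕ.+ suc k ℕ.* (0 C suc k)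
    ≡⟨ cong₂ (λ x y → suc (suc k) ℕ.* x ℕ.+ suc k ℕ.* y) (k>n⇒nCk≡0 {0} {suc (suc k)} (s≤s z≤n)) (k>n⇒nCk≡0 {0} {suc k} (s≤s z≤n)) ⟩
  suc (suc k) ℕ.* 0 ℕ.+ suc k ℕ.* 0 ≡⟨ cong₂ ℕ._+_ (ℕ.*-zeroʳ (suc (suc k))) (ℕ.*-zeroʳ (suc k)) ⟩
  0 ∎
absorption (suc n) zero = begin
  1 ℕ.* (suc n C 1) ℕ.+ 0 ≡⟨ cong (λ x → 1 ℕ.* x ℕ.+ 0) (sym (nCk+nC[k+1]≡[n+1]C[k+1] n 0)) ⟩
  1 ℕ.* ((n C 0) ℕ.+ (n C 1)) ℕ.+ 0 ≡⟨ solve 2 (λ a b → con 1 :* (a :+ b) :+ con 0 := a :+ (con 1 :* b :+ con 0)) refl (n C 0) (n C 1) ⟩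
  (n C 0) ℕ.+ (1 ℕ.* (n C 1) ℕ.+ 0) ≡⟨ cong ((n C 0) ℕ.+_) (absorption n 0) ⟩
  suc n ℕ.* (suc n C 0) ∎
  where open ℕSolver.+-*-Solver
absorption (suc n) (suc k) = begin
  suc (suc k) ℕ.* (suc n C suc (suc k)) ℕ.+ suc k ℕ.* (suc n C suc k)
    ≡⟨ cong₂ (λ x y → suc (suc k) ℕ.* x ℕ.+ suc k ℕ.* y) (sym (nCk+nC[k+1]≡[n+1]C[k+1] n (suc k))) (sym (nCk+nC[k+1]≡[n+1]C[k+1] n k)) ⟩
  suc (suc k) ℕ.* (b ℕ.+ c) ℕ.+ suc k ℕ.* (a ℕ.+ b)
    ≡⟨ solve 4 (λ k a b c → (con 2 :+ k) :* (b :+ c) :+ (con 1 :+ k) :* (a :+ b)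
                 := ((con 2 :+ k) :* c :+ (con 1 :+ k) :* b) :+ ((con 1 :+ k) :* b :+ k :* a) :+ (a :+ b)) refl k a b c ⟩
  (suc (suc k) ℕ.* c ℕ.+ suc k ℕ.* b) ℕ.+ (suc k ℕ.* b ℕ.+ k ℕ.* a) ℕ.+ (a ℕ.+ b)
    ≡⟨ cong₂ (λ x y → x ℕ.+ y ℕ.+ (a ℕ.+ b)) (absorption n (suc k)) (absorption n k) ⟩
  n ℕ.* b ℕ.+ n ℕ.* a ℕ.+ (a ℕ.+ b)
    ≡⟨ solve 3 (λ n a b → n :* b :+ n :* a :+ (a :+ b) := (con 1 :+ n) :* (a :+ b)) refl n a b ⟩
  suc n ℕ.* (a ℕ.+ b) ≡⟨ cong (suc n ℕ.*_) (nCk+nC[k+1]≡[n+1]C[k+1] n k) ⟩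
  suc n ℕ.* (suc n C suc k) ∎
  where
  open ℕSolver.+-*-Solver
  a = n C k
  b = n C suc k
  c = n C suc (suc k)

-- The identity behind column `c` of a lower factor, where `t` is the subdiagonal entry and `suc c`
-- the diagonal one.
lower-binomial : ∀ r c t →
  suc c ℕ.* ((r ℕ.+ suc t) C suc (c ℕ.+ t)) ℕ.+ t ℕ.* ((r ℕ.+ t) C suc (c ℕ.+ t))
    ≡ suc r ℕ.* ((r ℕ.+ t) C (c ℕ.+ t))
-- Adding `t * x` to both sides completes the left-hand side of `absorption` at `r + t` and `c + t`.
lower-binomial r c t = ℕ.+-cancelʳ-≡ (t ℕ.* x) _ _ (begin
  suc c ℕ.* ((r ℕ.+ suc t) C suc (c ℕ.+ t)) ℕ.+ t ℕ.* y ℕ.+ t ℕ.* x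
    ≡⟨ cong (λ z → suc c ℕ.* z ℕ.+ t ℕ.* y ℕ.+ t ℕ.* x)
         (trans (cong (_C suc (c ℕ.+ t)) (ℕ.+-suc r t)) (sym (nCk+nC[k+1]≡[n+1]C[k+1] (r ℕ.+ t) (c ℕ.+ t)))) ⟩
  suc c ℕ.* (x ℕ.+ y) ℕ.+ t ℕ.* y ℕ.+ t ℕ.* x
    ≡⟨ solve 4 (λ c t x y → (con 1 :+ c) :* (x :+ y) :+ t :* y :+ t :* x
         := ((con 1 :+ (c :+ t)) :* y :+ (c :+ t) :* x) :+ x) refl c t x y ⟩
  suc (c ℕ.+ t) ℕ.* y ℕ.+ (c ℕ.+ t) ℕ.* x ℕ.+ x
    ≡⟨ cong (ℕ._+ x) (absorption (r ℕ.+ t) (c ℕ.+ t)) ⟩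
  (r ℕ.+ t) ℕ.* x ℕ.+ x
    ≡⟨ solve 3 (λ r t x → (r :+ t) :* x :+ x := (con 1 :+ r) :* x :+ t :* x) refl r t x ⟩
  suc r ℕ.* x ℕ.+ t ℕ.* x ∎)
  where
  open ℕSolver.+-*-Solver
  x = (r ℕ.+ t) C (c ℕ.+ t)
  y = (r ℕ.+ t) C suc (c ℕ.+ t)

-- The identity behind a superdiagonal entry `k / suc k`. After multiplication by `suc k` and the
-- splitting of `suc r` into `1 + r`, it reduces to `absorption`.
upper-binomial : ∀ r k →
  fromℕ (r C suc k) + fromℕ (suc r) * fromℕ (r C k) * (ℤ.+ k / suc k) ≡ fromℕ r * fromℕ (r C k)
upper-binomial r k = fromℕ-suc-cancel k (begin
  K * (y + R * x * q)
    ≡⟨ solve 5 (λ K y R x q → K :* (y :+ R :* x :* q) := K :* y :+ (q :* K) :* (R :* x)) refl K y R x q ⟩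
  K * y + (q * K) * (R * x)
    ≡⟨ cong (λ z → K * y + z * (R * x)) (/-*-cancel k k) ⟩
  K * y + fromℕ k * (R * x)
    ≡⟨ cong (λ z → K * y + fromℕ k * (z * x)) (fromℕ-+ 1 r) ⟩
  K * y + fromℕ k * ((1ℚ + fromℕ r) * x)
    ≡⟨ solve 5 (λ K y k r x → K :* y :+ k :* ((con 1ℚ :+ r) :* x) := (K :* y :+ k :* x) :+ k :* (r :* x)) refl K y (fromℕ k) (fromℕ r) x ⟩
  (K * y + fromℕ k * x) + fromℕ k * (fromℕ r * x)
    ≡⟨ cong (_+ fromℕ k * (fromℕ r * x)) (cong₂ _+_ (sym (fromℕ-* (suc k) (r C suc k))) (sym (fromℕ-* k (r C k)))) ⟩
  (fromℕ (suc k ℕ.* (r C suc k)) + fromℕ (k ℕ.* (r C k))) + fromℕ k * (fromℕ r * x)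
    ≡⟨ cong (_+ fromℕ k * (fromℕ r * x)) (trans (sym (fromℕ-+ (suc k ℕ.* (r C suc k)) _)) (trans (cong fromℕ (absorption r k)) (fromℕ-* r (r C k)))) ⟩
  fromℕ r * x + fromℕ k * (fromℕ r * x)
    ≡⟨ solve 2 (λ a k → a :+ k :* a := (con 1ℚ :+ k) :* a) refl (fromℕ r * x) (fromℕ k) ⟩
  (1ℚ + fromℕ k) * (fromℕ r * x)
    ≡⟨ cong (_* (fromℕ r * x)) (fromℕ-+ 1 k) ⟨
  K * (fromℕ r * x) ∎)
  where
  open ℚSolver.+-*-Solver
  K = fromℕ (suc k)
  R = fromℕ (suc r)
  x = fromℕ (r C k)
  y = fromℕ (r C suc k)
  q = ℤ.+ k / suc k

-- Row vectors between consecutive factors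

∸-step : ∀ {m n} → m < n → n ∸ m ≡ suc (n ∸ suc m)
∸-step {zero}  {suc n} _         = refl
∸-step {suc m} {suc n} (s≤s m<n) = ∸-step m<n

-- Entry m of the row vector E W₀ ⋯ W_{k-1}, where n = d ∸ k and j = k ∸ d
-- (so n = 0 or j = 0).
stage : (r d n j m : ℕ) → ℕ
stage r d n j m = suc r ^ (d ∸ (m ℕ.+ (n ∸ m))) ℕ.* ((r ℕ.+ (n ∸ m)) C ((m ∸ j) ℕ.+ (n ∸ m))) ℕ.* r ^ (j ⊓ m)

-- Both entries on the left carry the power of `suc r` with exponent `d ∸ suc n`; `lower-binomial`
-- supplies the one further factor `suc r`.
stage-lower-≤ : ∀ r d n c → n < d → c ≤ n →
  stage r d (suc n) 0 c ℕ.* suc c ℕ.+ stage r d (suc n) 0 (suc c) ℕ.* (n ∸ c) ≡ stage r d n 0 c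
stage-lower-≤ r d n c n<d c≤n with ℕ.m≤n⇒∃[o]m+o≡n c≤n
... | t , refl
  rewrite ℕ.+-∸-assoc 1 (ℕ.m≤m+n c t) | ℕ.m+n∸m≡n c t | ℕ.+-suc c t | ∸-step n<d = begin
  p ℕ.* y ℕ.* 1 ℕ.* suc c ℕ.+ p ℕ.* z ℕ.* 1 ℕ.* t
    ≡⟨ solve 5 (λ p y z c t → p :* y :* con 1 :* (con 1 :+ c) :+ p :* z :* con 1 :* t
         := p :* ((con 1 :+ c) :* y :+ t :* z)) refl p y z c t ⟩
  p ℕ.* (suc c ℕ.* y ℕ.+ t ℕ.* z)
    ≡⟨ cong (p ℕ.*_) (lower-binomial r c t) ⟩
  p ℕ.* (suc r ℕ.* x)
    ≡⟨ solve 3 (λ p R x → p :* (R :* x) := (R :* p) :* x :* con 1) refl p (suc r) x ⟩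
  suc r ℕ.* p ℕ.* x ℕ.* 1 ∎
  where
  open ℕSolver.+-*-Solver
  p = suc r ^ (d ∸ suc (c ℕ.+ t))
  x = (r ℕ.+ t) C (c ℕ.+ t)
  y = (r ℕ.+ suc t) C suc (c ℕ.+ t)
  z = (r ℕ.+ t) C suc (c ℕ.+ t)

-- Here `suc n ∸ c` and `n ∸ c` are both zero: the entry has already reached (1+r)^(d-c) C(r,c).
stage-lower-> : ∀ r d n c → n < c → stage r d (suc n) 0 c ≡ stage r d n 0 c
stage-lower-> r d n c n<c rewrite ℕ.m≤n⇒m∸n≡0 n<c | ℕ.m≤n⇒m∸n≡0 (ℕ.<⇒≤ n<c) = refl

-- The binomial has lower index zero and the power of `r` has exponent `c` on both sides: the entry
-- is already (1+r)^(d-c) r^c.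
stage-upper-≤ : ∀ r d j c → c ≤ j → stage r d 0 j c ≡ stage r d 0 (suc j) c
stage-upper-≤ r d j c c≤j
  rewrite ℕ.m≤n⇒m∸n≡0 c≤j | ℕ.m≤n⇒m∸n≡0 (ℕ.m≤n⇒m≤1+n c≤j)
        | ℕ.m≥n⇒m⊓n≡n c≤j | ℕ.m≥n⇒m⊓n≡n (ℕ.m≤n⇒m≤1+n c≤j) = refl

fromℕ-*₃ : ∀ a b c → fromℕ (a ℕ.* b ℕ.* c) ≡ fromℕ a * fromℕ b * fromℕ c
fromℕ-*₃ a b c = trans (fromℕ-* (a ℕ.* b) c) (cong (_* fromℕ c) (fromℕ-* a b))

-- `p` and `s` stand for powers of `suc r` and `r`; the entry one column to the left has an extra
-- factor `suc r`.
upper-binomial-scaled : ∀ r k p s →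
  fromℕ (p ℕ.* (r C suc k) ℕ.* s) + fromℕ (suc r ℕ.* p ℕ.* (r C k) ℕ.* s) * (ℤ.+ k / suc k)
    ≡ fromℕ (p ℕ.* (r C k) ℕ.* (r ℕ.* s))
upper-binomial-scaled r k p s = begin
  fromℕ (p ℕ.* y ℕ.* s) + fromℕ (suc r ℕ.* p ℕ.* x ℕ.* s) * q
    ≡⟨ cong₂ (λ a b → a + b * q) (fromℕ-*₃ p y s)
         (trans (fromℕ-*₃ (suc r ℕ.* p) x s) (cong (λ z → z * fromℕ x * fromℕ s) (fromℕ-* (suc r) p))) ⟩
  fromℕ p * fromℕ y * fromℕ s + fromℕ (suc r) * fromℕ p * fromℕ x * fromℕ s * q
    ≡⟨ rearrange (fromℕ p) (fromℕ y) (fromℕ s) (fromℕ (suc r)) (fromℕ x) q ⟩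
  fromℕ p * (fromℕ y + fromℕ (suc r) * fromℕ x * q) * fromℕ s
    ≡⟨ cong (λ z → fromℕ p * z * fromℕ s) (upper-binomial r k) ⟩
  fromℕ p * (fromℕ r * fromℕ x) * fromℕ s
    ≡⟨ solve 4 (λ p r x s → p :* (r :* x) :* s := p :* x :* (r :* s)) refl (fromℕ p) (fromℕ r) (fromℕ x) (fromℕ s) ⟩
  fromℕ p * fromℕ x * (fromℕ r * fromℕ s)
    ≡⟨ cong (fromℕ p * fromℕ x *_) (fromℕ-* r s) ⟨
  fromℕ p * fromℕ x * fromℕ (r ℕ.* s)
    ≡⟨ fromℕ-*₃ p x (r ℕ.* s) ⟨
  fromℕ (p ℕ.* x ℕ.* (r ℕ.* s)) ∎
  where
  open ℚSolver.+-*-Solver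
  x = r C k
  y = r C suc k
  q = ℤ.+ k / suc k
  rearrange : ∀ p y s R x q → p * y * s + R * p * x * s * q ≡ p * (y + R * x * q) * s
  rearrange = solve 6 (λ p y s R x q → p :* y :* s :+ R :* p :* x :* s :* q := p :* (y :+ R :* x :* q) :* s) refl

-- The column is `m = j + k + 1`, so that `m - j` is `suc k`. The hypothesis keeps `d ∸ (j + k)`
-- positive, which yields the extra factor `suc r` of column `j + k`.
stage-upper-> : ∀ r d j k → j ℕ.+ k < d →
  fromℕ (stage r d 0 j (suc (j ℕ.+ k))) + fromℕ (stage r d 0 j (j ℕ.+ k)) * (ℤ.+ k / suc k)
    ≡ fromℕ (stage r d 0 (suc j) (suc (j ℕ.+ k)))
stage-upper-> r d j k j+k<d = begin
  fromℕ (stage r d 0 j (suc (j ℕ.+ k))) + fromℕ (stage r d 0 j (j ℕ.+ k)) * (ℤ.+ k / suc k)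
    ≡⟨ cong₂ (λ a b → fromℕ a + fromℕ b * (ℤ.+ k / suc k)) old-suc old ⟩
  fromℕ (p ℕ.* (r C suc k) ℕ.* r ^ j) + fromℕ (suc r ℕ.* p ℕ.* (r C k) ℕ.* r ^ j) * (ℤ.+ k / suc k)
    ≡⟨ upper-binomial-scaled r k p (r ^ j) ⟩
  fromℕ (p ℕ.* (r C k) ℕ.* r ^ suc j)
    ≡⟨ cong fromℕ new ⟨
  fromℕ (stage r d 0 (suc j) (suc (j ℕ.+ k))) ∎
  where
  p = suc r ^ (d ∸ suc (j ℕ.+ k))

  old-suc : stage r d 0 j (suc (j ℕ.+ k)) ≡ p ℕ.* (r C suc k) ℕ.* r ^ j
  old-suc rewrite ℕ.+-identityʳ r | ℕ.+-identityʳ (j ℕ.+ k) | ℕ.+-∸-assoc 1 (ℕ.m≤m+n j k)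
    | ℕ.m+n∸m≡n j k | ℕ.+-identityʳ k | ℕ.m≤n⇒m⊓n≡m (ℕ.m≤n⇒m≤1+n (ℕ.m≤m+n j k)) = refl

  old : stage r d 0 j (j ℕ.+ k) ≡ suc r ℕ.* p ℕ.* (r C k) ℕ.* r ^ j
  old rewrite ℕ.0∸n≡0 (j ℕ.+ k) | ℕ.+-identityʳ r | ℕ.+-identityʳ (j ℕ.+ k) | ∸-step j+k<d
    | ℕ.m+n∸m≡n j k | ℕ.+-identityʳ k | ℕ.m≤n⇒m⊓n≡m (ℕ.m≤m+n j k) = refl

  new : stage r d 0 (suc j) (suc (j ℕ.+ k)) ≡ p ℕ.* (r C k) ℕ.* r ^ suc j
  new rewrite ℕ.+-identityʳ r | ℕ.+-identityʳ (j ℕ.+ k) | ℕ.m+n∸m≡n j k | ℕ.+-identityʳ k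
    | ℕ.m≤n⇒m⊓n≡m (ℕ.m≤m+n j k) = refl

-- Multiplication by a single factor

-- Outside the range `m < d ∸ i` the truncated difference is zero, in agreement with the default
-- value of the conditional.
lowerSub≡ : ∀ d i m → lowerSub d i m ≡ fromℕ (d ∸ i ∸ m)
lowerSub≡ d i m = by-cases (m ℕ.<? (d ∸ i))
  where
  by-cases : Dec (m < d ∸ i) → lowerSub d i m ≡ fromℕ (d ∸ i ∸ m)
  by-cases (yes m<d∸i) = cong (λ b → if b then fromℕ (d ∸ i ∸ m) else 0ℚ) (dec-true (m ℕ.<? (d ∸ i)) m<d∸i)
  by-cases (no  m≮d∸i) = trans (cong (λ b → if b then fromℕ (d ∸ i ∸ m) else 0ℚ) (dec-false (m ℕ.<? (d ∸ i)) m≮d∸i))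
                               (sym (cong fromℕ (ℕ.m≤n⇒m∸n≡0 (ℕ.≮⇒≥ m≮d∸i))))

upperSuper-≤ : ∀ j m → m ≤ j → upperSuper j m ≡ 0ℚ
upperSuper-≤ j m m≤j rewrite ℕ.m≤n⇒m∸n≡0 m≤j = refl

upperSuper-> : ∀ j k → upperSuper j (suc (j ℕ.+ k)) ≡ ℤ.+ k / suc k
upperSuper-> j k rewrite ℕ.+-∸-assoc 1 (ℕ.m≤m+n j k) | ℕ.m+n∸m≡n j k = refl

-- `d ∸ k` is the number of lower factors still to come and `k ∸ d` the number of upper factors
-- already applied; truncation covers both phases at once.
stageRow : ∀ r d k {n} → Fin n → ℚ
stageRow r d k m = fromℕ (stage r d (d ∸ k) (k ∸ d) (toℕ m))

lower-step : ∀ r d k → k < d → ∀ c → (stageRow r d k ᵥ⊗ lower d k) c ≡ stageRow r d (suc k) c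
lower-step r d k k<d c = begin
  (stageRow r d k ᵥ⊗ lower d k) c
    ≡⟨ ∑-lowerBidiagonal (λ m → fromℕ (stage r d (d ∸ k) (k ∸ d) m)) (lowerDiag d k) (lowerSub d k) c
         -- The entry below the last row, at index `suc d`, vanishes as `∑-lowerBidiagonal` demands.
         (trans (lowerSub≡ d k (suc d)) (cong fromℕ (ℕ.m≤n⇒m∸n≡0 (ℕ.m≤n⇒m≤1+n (ℕ.m∸n≤m d k))))) ⟩
  fromℕ (stage r d (d ∸ k) (k ∸ d) m) * lowerDiag d k m + fromℕ (stage r d (d ∸ k) (k ∸ d) (suc m)) * lowerSub d k (suc m)
    ≡⟨ cong₂ (λ j β → fromℕ (stage r d (d ∸ k) j m) * lowerDiag d k m + fromℕ (stage r d (d ∸ k) j (suc m)) * β)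
         (ℕ.m≤n⇒m∸n≡0 (ℕ.<⇒≤ k<d)) (lowerSub≡ d k (suc m)) ⟩
  fromℕ (stage r d (d ∸ k) 0 m) * lowerDiag d k m + fromℕ (stage r d (d ∸ k) 0 (suc m)) * fromℕ (d ∸ k ∸ suc m)
    ≡⟨ cong (λ n → fromℕ (stage r d n 0 m) * (if m <ᵇ n then fromℕ (suc m) else 1ℚ) + fromℕ (stage r d n 0 (suc m)) * fromℕ (n ∸ suc m))
         (∸-step k<d) ⟩
  fromℕ (stage r d (suc n) 0 m) * (if m <ᵇ suc n then fromℕ (suc m) else 1ℚ) + fromℕ (stage r d (suc n) 0 (suc m)) * fromℕ (n ∸ m)
    ≡⟨ by-cases (m ℕ.≤? n) ⟩
  fromℕ (stage r d n 0 m)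
    ≡⟨ cong (λ j → fromℕ (stage r d n j m)) (ℕ.m≤n⇒m∸n≡0 k<d) ⟨
  stageRow r d (suc k) c ∎
  where
  m = toℕ c
  n = d ∸ suc k
  by-cases : Dec (m ≤ n) →
    fromℕ (stage r d (suc n) 0 m) * (if m <ᵇ suc n then fromℕ (suc m) else 1ℚ) + fromℕ (stage r d (suc n) 0 (suc m)) * fromℕ (n ∸ m)
      ≡ fromℕ (stage r d n 0 m)
  by-cases (yes m≤n) = begin
    fromℕ (stage r d (suc n) 0 m) * (if m <ᵇ suc n then fromℕ (suc m) else 1ℚ) + fromℕ (stage r d (suc n) 0 (suc m)) * fromℕ (n ∸ m)
      ≡⟨ cong (λ b → fromℕ (stage r d (suc n) 0 m) * (if b then fromℕ (suc m) else 1ℚ) + fromℕ (stage r d (suc n) 0 (suc m)) * fromℕ (n ∸ m))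
           (dec-true (m ℕ.<? suc n) (s≤s m≤n)) ⟩
    fromℕ (stage r d (suc n) 0 m) * fromℕ (suc m) + fromℕ (stage r d (suc n) 0 (suc m)) * fromℕ (n ∸ m)
      ≡⟨ cong₂ _+_ (fromℕ-* (stage r d (suc n) 0 m) (suc m)) (fromℕ-* (stage r d (suc n) 0 (suc m)) (n ∸ m)) ⟨
    fromℕ (stage r d (suc n) 0 m ℕ.* suc m) + fromℕ (stage r d (suc n) 0 (suc m) ℕ.* (n ∸ m))
      ≡⟨ fromℕ-+ (stage r d (suc n) 0 m ℕ.* suc m) _ ⟨
    fromℕ (stage r d (suc n) 0 m ℕ.* suc m ℕ.+ stage r d (suc n) 0 (suc m) ℕ.* (n ∸ m))
      ≡⟨ cong fromℕ (stage-lower-≤ r d n m (ℕ.∸-monoʳ-< (s≤s z≤n) k<d) m≤n) ⟩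
    fromℕ (stage r d n 0 m) ∎
  by-cases (no m≰n) = begin
    fromℕ (stage r d (suc n) 0 m) * (if m <ᵇ suc n then fromℕ (suc m) else 1ℚ) + fromℕ (stage r d (suc n) 0 (suc m)) * fromℕ (n ∸ m)
      ≡⟨ cong₂ (λ b z → fromℕ (stage r d (suc n) 0 m) * (if b then fromℕ (suc m) else 1ℚ) + fromℕ (stage r d (suc n) 0 (suc m)) * fromℕ z)
           (dec-false (m ℕ.<? suc n) (m≰n ∘ ℕ.≤-pred)) (ℕ.m≤n⇒m∸n≡0 (ℕ.≰⇒≥ m≰n)) ⟩
    fromℕ (stage r d (suc n) 0 m) * 1ℚ + fromℕ (stage r d (suc n) 0 (suc m)) * 0ℚ
      ≡⟨ cong₂ _+_ (ℚ.*-identityʳ (fromℕ (stage r d (suc n) 0 m))) (ℚ.*-zeroʳ (fromℕ (stage r d (suc n) 0 (suc m)))) ⟩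
    fromℕ (stage r d (suc n) 0 m) + 0ℚ
      ≡⟨ ℚ.+-identityʳ _ ⟩
    fromℕ (stage r d (suc n) 0 m)
      ≡⟨ cong fromℕ (stage-lower-> r d n m (ℕ.≰⇒> m≰n)) ⟩
    fromℕ (stage r d n 0 m) ∎

upper-step : ∀ r d j c →
  ((λ m → fromℕ (stage r d 0 j (toℕ m))) ᵥ⊗ upper d j) c ≡ fromℕ (stage r d 0 (suc j) (toℕ c))
upper-step r d j zero =
  trans (∑-upperBidiagonal-zero d (λ m → fromℕ (stage r d 0 j m)) (upperSuper j 0))
        (cong fromℕ (stage-upper-≤ r d j 0 z≤n))
upper-step r d j (suc c) =
  trans (∑-upperBidiagonal-suc (λ m → fromℕ (stage r d 0 j m)) (upperSuper j (suc (toℕ c))) c)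
        (by-cases (suc (toℕ c) ℕ.≤? j))
  where
  by-cases : Dec (suc (toℕ c) ≤ j) →
    fromℕ (stage r d 0 j (suc (toℕ c))) + fromℕ (stage r d 0 j (toℕ c)) * upperSuper j (suc (toℕ c))
      ≡ fromℕ (stage r d 0 (suc j) (suc (toℕ c)))
  by-cases (yes c<j) = begin
    fromℕ (stage r d 0 j (suc (toℕ c))) + fromℕ (stage r d 0 j (toℕ c)) * upperSuper j (suc (toℕ c))
      ≡⟨ cong₂ (λ a b → fromℕ a + fromℕ (stage r d 0 j (toℕ c)) * b) (stage-upper-≤ r d j (suc (toℕ c)) c<j) (upperSuper-≤ j (suc (toℕ c)) c<j) ⟩
    fromℕ (stage r d 0 (suc j) (suc (toℕ c))) + fromℕ (stage r d 0 j (toℕ c)) * 0ℚ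
      ≡⟨ cong (fromℕ (stage r d 0 (suc j) (suc (toℕ c))) +_) (ℚ.*-zeroʳ (fromℕ (stage r d 0 j (toℕ c)))) ⟩
    fromℕ (stage r d 0 (suc j) (suc (toℕ c))) + 0ℚ
      ≡⟨ ℚ.+-identityʳ _ ⟩
    fromℕ (stage r d 0 (suc j) (suc (toℕ c))) ∎
  -- `toℕ c` is not a variable, so the form `j + k` is transported along an equation. Its bound by
  -- `d` comes from `c` lying in `Fin d`.
  by-cases (no c≮j) = let (k , j+k≡c) = ℕ.m≤n⇒∃[o]m+o≡n (ℕ.≮⇒≥ c≮j) in subst
    (λ c → fromℕ (stage r d 0 j (suc c)) + fromℕ (stage r d 0 j c) * upperSuper j (suc c) ≡ fromℕ (stage r d 0 (suc j) (suc c)))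
    j+k≡c
    (trans (cong (λ b → fromℕ (stage r d 0 j (suc (j ℕ.+ k))) + fromℕ (stage r d 0 j (j ℕ.+ k)) * b) (upperSuper-> j k))
           (stage-upper-> r d j k (subst (_< d) (sym j+k≡c) (toℕ<n c))))

W-step : ∀ r d k c → (stageRow r d k ᵥ⊗ W d k) c ≡ stageRow r d (suc k) c
W-step r d k c = by-cases (k ℕ.<? d)
  where
  by-cases : Dec (k < d) → (stageRow r d k ᵥ⊗ W d k) c ≡ stageRow r d (suc k) c
  by-cases (yes k<d) = trans (cong (λ b → (stageRow r d k ᵥ⊗ (if b then lower d k else upper d (k ∸ d))) c) (dec-true (k ℕ.<? d) k<d))
                      (lower-step r d k k<d c)
  by-cases (no k≮d) = begin
    (stageRow r d k ᵥ⊗ W d k) c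
      ≡⟨ cong (λ b → (stageRow r d k ᵥ⊗ (if b then lower d k else upper d (k ∸ d))) c) (dec-false (k ℕ.<? d) k≮d) ⟩
    (stageRow r d k ᵥ⊗ upper d (k ∸ d)) c
      ≡⟨ cong (λ n → ((λ m → fromℕ (stage r d n (k ∸ d) (toℕ m))) ᵥ⊗ upper d (k ∸ d)) c) (ℕ.m≤n⇒m∸n≡0 (ℕ.≮⇒≥ k≮d)) ⟩
    ((λ m → fromℕ (stage r d 0 (k ∸ d) (toℕ m))) ᵥ⊗ upper d (k ∸ d)) c
      ≡⟨ upper-step r d (k ∸ d) c ⟩
    fromℕ (stage r d 0 (suc (k ∸ d)) (toℕ c))
      ≡⟨ cong₂ (λ n j → fromℕ (stage r d n j (toℕ c))) (ℕ.m≤n⇒m∸n≡0 (ℕ.m≤n⇒m≤1+n (ℕ.≮⇒≥ k≮d))) (ℕ.+-∸-assoc 1 (ℕ.≮⇒≥ k≮d)) ⟨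
    stageRow r d (suc k) c ∎

-- First and last row vectors

-- For `k ≤ d` this is the coefficient of x^r in x^k / (1-x)^(d+1).
shiftedBinomial : (r d k : ℕ) → ℕ
shiftedBinomial r d k = (r ℕ.+ (d ∸ k)) C d

mixedPower : (r d k : ℕ) → ℕ
mixedPower r d k = suc r ^ (d ∸ k) ℕ.* r ^ k

stage-first : ∀ r d m → m ≤ d → stage r d d 0 m ≡ shiftedBinomial r d m
stage-first r d m m≤d rewrite ℕ.m+[n∸m]≡n m≤d | ℕ.n∸n≡0 d = trans (ℕ.*-identityʳ _) (ℕ.*-identityˡ _)

stage-last : ∀ r d m → m ≤ d → stage r d 0 d m ≡ mixedPower r d m
stage-last r d m m≤d rewrite ℕ.0∸n≡0 m | ℕ.+-identityʳ m | ℕ.m≤n⇒m∸n≡0 m≤d | ℕ.m≥n⇒m⊓n≡n m≤d =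
  cong (ℕ._* r ^ m) (ℕ.*-identityʳ (suc r ^ (d ∸ m)))

shiftedBinomial-W : ∀ r d c →
  ((λ m → fromℕ (shiftedBinomial r d (toℕ m))) ᵥ⊗ product (map (W d) (upTo (2 ℕ.* d)))) c
    ≡ fromℕ (mixedPower r d (toℕ c))
shiftedBinomial-W r d c = begin
  sum (λ m → fromℕ (shiftedBinomial r d (toℕ m)) * product (map (W d) (upTo (2 ℕ.* d))) m c)
    ≡⟨ sum-cong-≗ (λ m → cong₂ (λ a Ws → fromℕ a * product Ws m c)
         (trans (sym (stage-first r d (toℕ m) (toℕ≤pred[n] m))) (cong (λ j → stage r d d j (toℕ m)) (sym (ℕ.0∸n≡0 d))))
         (map-upTo (W d) (2 ℕ.* d))) ⟩
  (stageRow r d 0 ᵥ⊗ product (applyUpTo (W d) (2 ℕ.* d))) c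
    ≡⟨ ᵥ⊗-product (W d) (λ k m → fromℕ (stage r d (d ∸ k) (k ∸ d) m)) (2 ℕ.* d) (λ k _ → W-step r d k) c ⟩
  fromℕ (stage r d (d ∸ 2 ℕ.* d) (2 ℕ.* d ∸ d) (toℕ c))
    ≡⟨ cong₂ (λ n j → fromℕ (stage r d n j (toℕ c)))
         (ℕ.m≤n⇒m∸n≡0 (ℕ.m≤m+n d (d ℕ.+ 0))) (trans (ℕ.m+n∸m≡n d (d ℕ.+ 0)) (ℕ.+-identityʳ d)) ⟩
  fromℕ (stage r d 0 d (toℕ c))
    ≡⟨ cong fromℕ (stage-last r d (toℕ c) (toℕ≤pred[n] c)) ⟩
  fromℕ (mixedPower r d (toℕ c)) ∎

-- Linear functionals on polynomials

xᵃ[1-x]ᵇ-degree : ∀ a b k → a ℕ.+ b < k → xᵃ[1-x]ᵇ a b k ≡ 0ℚ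
xᵃ[1-x]ᵇ-degree (suc a) b       (suc k) (s≤s a+b<k) = xᵃ[1-x]ᵇ-degree a b k a+b<k
xᵃ[1-x]ᵇ-degree zero    zero    (suc k) _           = refl
xᵃ[1-x]ᵇ-degree zero    (suc b) (suc k) (s≤s b<k)   =
  cong₂ _-_ (xᵃ[1-x]ᵇ-degree zero b (suc k) (ℕ.m≤n⇒m≤1+n b<k)) (xᵃ[1-x]ᵇ-degree zero b k b<k)

xᵃ[1-x]ᵇ-order : ∀ a b k → k < a → xᵃ[1-x]ᵇ a b k ≡ 0ℚ
xᵃ[1-x]ᵇ-order (suc a) b zero    _         = refl
xᵃ[1-x]ᵇ-order (suc a) b (suc k) (s≤s k<a) = xᵃ[1-x]ᵇ-order a b k k<a

-- Together with `xᵃ[1-x]ᵇ-order` this makes the coefficient matrix of the polynomials xⁱ(1-x)ᵈ⁻ⁱ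
-- upper unitriangular.
xᵃ[1-x]ᵇ-lowest : ∀ a b → xᵃ[1-x]ᵇ a b a ≡ 1ℚ
xᵃ[1-x]ᵇ-lowest (suc a) b       = xᵃ[1-x]ᵇ-lowest a b
xᵃ[1-x]ᵇ-lowest zero    zero    = refl
xᵃ[1-x]ᵇ-lowest zero    (suc b) = cong (_- 0ℚ) (xᵃ[1-x]ᵇ-lowest zero b)

-- The linear functional that sends x^k to `g k`, applied to `p` up to degree `n`.
pair : ℕ → Poly → (ℕ → ℚ) → ℚ
pair n p g = sum {suc n} λ k → p (toℕ k) * g (toℕ k)

pair-x· : ∀ n p g → pair (suc n) (x· p) g ≡ pair n p (g ∘ suc)
pair-x· n p g = trans (cong (_+ pair n p (g ∘ suc)) (ℚ.*-zeroˡ (g 0))) (ℚ.+-identityˡ _)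

pair-suc : ∀ n p g → p (suc n) ≡ 0ℚ → pair (suc n) p g ≡ pair n p g
pair-suc n p g pₙ₊₁≡0 = begin
  pair (suc n) p g
    ≡⟨ sum-init-last {suc n} (λ k → p (toℕ k) * g (toℕ k)) ⟩
  sum {suc n} (λ k → p (toℕ (inject₁ k)) * g (toℕ (inject₁ k))) + p (toℕ (fromℕᶠ (suc n))) * g (toℕ (fromℕᶠ (suc n)))
    ≡⟨ cong₂ _+_ (sum-cong-≗ {suc n} λ k → cong (λ i → p i * g i) (toℕ-inject₁ k))
                 (trans (cong (λ i → p i * g i) (toℕ-fromℕ (suc n))) (trans (cong (_* g (suc n)) pₙ₊₁≡0) (ℚ.*-zeroˡ (g (suc n))))) ⟩
  pair n p g + 0ℚ
    ≡⟨ ℚ.+-identityʳ _ ⟩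
  pair n p g ∎

-- Multiplication by 1 - x on coefficients is the difference operator on the dual side.
pair-[1-x]· : ∀ n p (g h : ℕ → ℚ) → p (suc n) ≡ 0ℚ → (∀ k → k ≤ n → g k ≡ g (suc k) + h k) →
              pair (suc n) ([1-x]· p) g ≡ pair n p h
pair-[1-x]· n p g h pₙ₊₁≡0 g-h = begin
  pair (suc n) ([1-x]· p) g
    ≡⟨ sum-cong-≗ {suc (suc n)} (λ k → solve 3 (λ a b c → (a :- b) :* c := a :* c :+ b :* (:- c)) refl (p (toℕ k)) (x· p (toℕ k)) (g (toℕ k))) ⟩
  sum {suc (suc n)} (λ k → p (toℕ k) * g (toℕ k) + x· p (toℕ k) * - g (toℕ k))
    ≡⟨ ∑-distrib-+ {suc (suc n)} (λ k → p (toℕ k) * g (toℕ k)) (λ k → x· p (toℕ k) * - g (toℕ k)) ⟩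
  pair (suc n) p g + pair (suc n) (x· p) (λ k → - g k)
    ≡⟨ cong₂ _+_ (pair-suc n p g pₙ₊₁≡0) (pair-x· n p (λ k → - g k)) ⟩
  pair n p g + pair n p (λ k → - g (suc k))
    ≡⟨ ∑-distrib-+ {suc n} (λ k → p (toℕ k) * g (toℕ k)) (λ k → p (toℕ k) * - g (suc (toℕ k))) ⟨
  sum {suc n} (λ k → p (toℕ k) * g (toℕ k) + p (toℕ k) * - g (suc (toℕ k)))
    ≡⟨ sum-cong-≗ {suc n} (λ k → trans
         (cong (λ z → p (toℕ k) * z + p (toℕ k) * - g (suc (toℕ k))) (g-h (toℕ k) (toℕ≤pred[n] k)))
         (solve 3 (λ p s h → p :* (s :+ h) :+ p :* (:- s) := p :* h) refl (p (toℕ k)) (g (suc (toℕ k))) (h (toℕ k)))) ⟩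
  pair n p h ∎
  where open ℚSolver.+-*-Solver

-- Pascal-type triangles are dual to the polynomials xᵃ(1-x)ᵇ.
pair-xᵃ[1-x]ᵇ : ∀ a b (g : ℕ → ℕ → ℚ) → (∀ d k → k ≤ d → g (suc d) k ≡ g (suc d) (suc k) + g d k) →
                pair (a ℕ.+ b) (xᵃ[1-x]ᵇ a b) (g (a ℕ.+ b)) ≡ g a a
pair-xᵃ[1-x]ᵇ (suc a) b g pascal = begin
  pair (suc (a ℕ.+ b)) (x· (xᵃ[1-x]ᵇ a b)) (g (suc (a ℕ.+ b)))
    ≡⟨ pair-x· (a ℕ.+ b) (xᵃ[1-x]ᵇ a b) (g (suc (a ℕ.+ b))) ⟩
  pair (a ℕ.+ b) (xᵃ[1-x]ᵇ a b) (g (suc (a ℕ.+ b)) ∘ suc)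
    -- The triangle shifted in both indices obeys the same rule.
    ≡⟨ pair-xᵃ[1-x]ᵇ a b (λ d k → g (suc d) (suc k)) (λ d k k≤d → pascal (suc d) (suc k) (s≤s k≤d)) ⟩
  g (suc a) (suc a) ∎
pair-xᵃ[1-x]ᵇ zero zero g pascal = trans (ℚ.+-identityʳ _) (ℚ.*-identityˡ (g 0 0))
pair-xᵃ[1-x]ᵇ zero (suc b) g pascal = trans
  (pair-[1-x]· b (xᵃ[1-x]ᵇ 0 b) (g (suc b)) (g b) (xᵃ[1-x]ᵇ-degree 0 b (suc b) ℕ.≤-refl) (pascal b))
  (pair-xᵃ[1-x]ᵇ zero b g pascal)

pascal-shiftedBinomial : ∀ r d k → k ≤ d →
  fromℕ (shiftedBinomial r (suc d) k) ≡ fromℕ (shiftedBinomial r (suc d) (suc k)) + fromℕ (shiftedBinomial r d k)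
pascal-shiftedBinomial r d k k≤d = begin
  fromℕ ((r ℕ.+ (suc d ∸ k)) C suc d)
    ≡⟨ cong (λ n → fromℕ (n C suc d)) (trans (cong (r ℕ.+_) (ℕ.+-∸-assoc 1 k≤d)) (ℕ.+-suc r (d ∸ k))) ⟩
  fromℕ (suc (r ℕ.+ (d ∸ k)) C suc d)
    ≡⟨ cong fromℕ (trans (ℕ.+-comm ((r ℕ.+ (d ∸ k)) C suc d) _) (nCk+nC[k+1]≡[n+1]C[k+1] (r ℕ.+ (d ∸ k)) d)) ⟨
  fromℕ ((r ℕ.+ (d ∸ k)) C suc d ℕ.+ (r ℕ.+ (d ∸ k)) C d)
    ≡⟨ fromℕ-+ ((r ℕ.+ (d ∸ k)) C suc d) _ ⟩
  fromℕ ((r ℕ.+ (d ∸ k)) C suc d) + fromℕ ((r ℕ.+ (d ∸ k)) C d) ∎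

-- One factor `1 + r` of the first power is split into `r` and `1`.
pascal-mixedPower : ∀ r d k → k ≤ d →
  fromℕ (mixedPower r (suc d) k) ≡ fromℕ (mixedPower r (suc d) (suc k)) + fromℕ (mixedPower r d k)
pascal-mixedPower r d k k≤d = trans
  (cong fromℕ (trans (cong (λ n → suc r ^ n ℕ.* r ^ k) (ℕ.+-∸-assoc 1 k≤d))
    (solve 3 (λ r p q → (con 1 :+ r) :* p :* q := p :* (r :* q) :+ p :* q) refl r (suc r ^ (d ∸ k)) (r ^ k))))
  (fromℕ-+ (mixedPower r (suc d) (suc k)) _)
  where open ℕSolver.+-*-Solver

∑-hVector : ∀ d Δ (g : Fin (suc d) → ℚ) →
  sum (λ k → hVector d Δ k * g k)
    ≡ sum {suc d} (λ i → fromℕ (faceCount Δ (toℕ i)) * sum (λ k → xᵃ[1-x]ᵇ (toℕ i) (d ∸ toℕ i) (toℕ k) * g k))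
∑-hVector d Δ g = sym (∑-assoc {suc d} {suc d} (λ i → fromℕ (faceCount Δ (toℕ i))) (λ i k → xᵃ[1-x]ᵇ (toℕ i) (d ∸ toℕ i) (toℕ k)) g)

-- The functional takes the value `g i i` on xⁱ(1-x)ᵈ⁻ⁱ, so pairing with the h-vector becomes
-- pairing the face numbers with the diagonal of the triangle.
∑-hVector-pascal : ∀ d Δ (g : ℕ → ℕ → ℚ) → (∀ d k → k ≤ d → g (suc d) k ≡ g (suc d) (suc k) + g d k) →
  sum {suc d} (λ k → hVector d Δ k * g d (toℕ k)) ≡ sum {suc d} (λ i → fromℕ (faceCount Δ (toℕ i)) * g (toℕ i) (toℕ i))
∑-hVector-pascal d Δ g pascal = trans (∑-hVector d Δ (λ k → g d (toℕ k)))
  (sum-cong-≗ {suc d} λ i → cong (fromℕ (faceCount Δ (toℕ i)) *_)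
    (trans (cong (λ n → pair n (xᵃ[1-x]ᵇ (toℕ i) (d ∸ toℕ i)) (g n)) (sym (ℕ.m+[n∸m]≡n (toℕ≤pred[n] i))))
           (pair-xᵃ[1-x]ᵇ (toℕ i) (d ∸ toℕ i) g pascal)))

∑-hVector-shiftedBinomial : ∀ r d Δ →
  sum {suc d} (λ k → hVector d Δ k * fromℕ (shiftedBinomial r d (toℕ k)))
    ≡ sum {suc d} (λ i → fromℕ (faceCount Δ (toℕ i)) * fromℕ (r C toℕ i))
∑-hVector-shiftedBinomial r d Δ = trans
  (∑-hVector-pascal d Δ (λ d k → fromℕ (shiftedBinomial r d k)) (pascal-shiftedBinomial r))
  (sum-cong-≗ {suc d} λ i → cong (λ n → fromℕ (faceCount Δ (toℕ i)) * fromℕ (n C toℕ i))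
    (trans (cong (r ℕ.+_) (ℕ.n∸n≡0 (toℕ i))) (ℕ.+-identityʳ r)))

∑-hVector-mixedPower : ∀ r d Δ →
  sum {suc d} (λ k → hVector d Δ k * fromℕ (mixedPower r d (toℕ k)))
    ≡ sum {suc d} (λ i → fromℕ (faceCount Δ (toℕ i)) * fromℕ (r ^ toℕ i))
∑-hVector-mixedPower r d Δ = trans
  (∑-hVector-pascal d Δ (λ d k → fromℕ (mixedPower r d k)) (pascal-mixedPower r))
  (sum-cong-≗ {suc d} λ i → cong (λ n → fromℕ (faceCount Δ (toℕ i)) * fromℕ n)
    (trans (cong (λ n → suc r ^ n ℕ.* r ^ toℕ i) (ℕ.n∸n≡0 (toℕ i))) (ℕ.*-identityˡ (r ^ toℕ i))))

-- Triangular systems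

x*y≡0⇒x≡0 : ∀ x y → y ≢ 0ℚ → x * y ≡ 0ℚ → x ≡ 0ℚ
x*y≡0⇒x≡0 x y y≢0 xy≡0 = begin
  x                ≡⟨ ℚ.*-identityʳ x ⟨
  x * 1ℚ           ≡⟨ cong (x *_) (ℚ.*-inverseʳ y) ⟨
  x * (y * 1/ y)   ≡⟨ ℚ.*-assoc x y (1/ y) ⟨
  x * y * 1/ y     ≡⟨ cong (_* 1/ y) xy≡0 ⟩
  0ℚ * 1/ y        ≡⟨ ℚ.*-zeroˡ (1/ y) ⟩
  0ℚ               ∎
  where instance _ = ≢-nonZero y≢0

lowerTriangular-injective : ∀ {n} (T : Fin n → Fin n → ℚ) (v : Fin n → ℚ) →
  (∀ r c → r <ᶠ c → T r c ≡ 0ℚ) → (∀ r → T r r ≢ 0ℚ) →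
  (∀ r → sum (λ c → v c * T r c) ≡ 0ℚ) → ∀ c → v c ≡ 0ℚ
lowerTriangular-injective {suc n} T v tri diag Tv≡0 = λ where
    zero    → v₀≡0
    (suc c) → lowerTriangular-injective (λ r c → T (suc r) (suc c)) (v ∘ suc)
                (λ r c r<c → tri (suc r) (suc c) (s≤s r<c)) (diag ∘ suc) tail c
  where
  v₀≡0 : v zero ≡ 0ℚ
  v₀≡0 = x*y≡0⇒x≡0 (v zero) (T zero zero) (diag zero) (begin
    v zero * T zero zero
      ≡⟨ ℚ.+-identityʳ _ ⟨
    v zero * T zero zero + 0ℚ
      ≡⟨ cong (v zero * T zero zero +_) (sum-zero n λ c → trans (cong (v (suc c) *_) (tri zero (suc c) (s≤s z≤n))) (ℚ.*-zeroʳ (v (suc c)))) ⟨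
    sum (λ c → v c * T zero c)
      ≡⟨ Tv≡0 zero ⟩
    0ℚ ∎)

  tail : ∀ r → sum (λ c → v (suc c) * T (suc r) (suc c)) ≡ 0ℚ
  tail r = begin
    sum (λ c → v (suc c) * T (suc r) (suc c))
      ≡⟨ ℚ.+-identityˡ _ ⟨
    0ℚ + sum (λ c → v (suc c) * T (suc r) (suc c))
      ≡⟨ cong (_+ sum (λ c → v (suc c) * T (suc r) (suc c))) (trans (cong (_* T (suc r) zero) v₀≡0) (ℚ.*-zeroˡ (T (suc r) zero))) ⟨
    sum (λ c → v c * T (suc r) c)
      ≡⟨ Tv≡0 (suc r) ⟩
    0ℚ ∎

-- Back substitution: column zero vanishes below the diagonal, so the tail solves a smaller system
-- and is treated first.
upperTriangular-injective : ∀ {n} (T : Fin n → Fin n → ℚ) (v : Fin n → ℚ) →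
  (∀ r c → c <ᶠ r → T r c ≡ 0ℚ) → (∀ r → T r r ≢ 0ℚ) →
  (∀ r → sum (λ c → v c * T r c) ≡ 0ℚ) → ∀ c → v c ≡ 0ℚ
upperTriangular-injective {suc n} T v tri diag Tv≡0 = λ where
    zero    → x*y≡0⇒x≡0 (v zero) (T zero zero) (diag zero) (begin
      v zero * T zero zero
        ≡⟨ ℚ.+-identityʳ _ ⟨
      v zero * T zero zero + 0ℚ
        ≡⟨ cong (v zero * T zero zero +_) (sum-zero n λ c → trans (cong (_* T zero (suc c)) (tail≡0 c)) (ℚ.*-zeroˡ (T zero (suc c)))) ⟨
      sum (λ c → v c * T zero c)
        ≡⟨ Tv≡0 zero ⟩
      0ℚ ∎)
    (suc c) → tail≡0 c
  where
  tail≡0 : ∀ c → v (suc c) ≡ 0ℚ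
  tail≡0 = upperTriangular-injective (λ r c → T (suc r) (suc c)) (v ∘ suc)
    (λ r c c<r → tri (suc r) (suc c) (s≤s c<r)) (diag ∘ suc)
    λ r → begin
      sum (λ c → v (suc c) * T (suc r) (suc c))
        ≡⟨ ℚ.+-identityˡ _ ⟨
      0ℚ + sum (λ c → v (suc c) * T (suc r) (suc c))
        ≡⟨ cong (_+ sum (λ c → v (suc c) * T (suc r) (suc c))) (trans (cong (v zero *_) (tri (suc r) zero (s≤s z≤n))) (ℚ.*-zeroʳ (v zero))) ⟨
      sum (λ c → v c * T (suc r) c)
        ≡⟨ Tv≡0 (suc r) ⟩
      0ℚ ∎

-- Sums of natural numbers over lists

∑ : ∀ {A : Set} → List A → (A → ℕ) → ℕ
∑ xs f = ListAction.sum (map f xs)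

∑-cong-All : ∀ {A : Set} {xs : List A} {f g : A → ℕ} → All (λ x → f x ≡ g x) xs → ∑ xs f ≡ ∑ xs g
∑-cong-All []         = refl
∑-cong-All (eq ∷ eqs) = cong₂ ℕ._+_ eq (∑-cong-All eqs)

∑-cong : ∀ {A : Set} (xs : List A) {f g : A → ℕ} → (∀ x → f x ≡ g x) → ∑ xs f ≡ ∑ xs g
∑-cong xs f≗g = cong ListAction.sum (map-cong f≗g xs)

∑-zero : ∀ {A : Set} (xs : List A) {f : A → ℕ} → (∀ x → f x ≡ 0) → ∑ xs f ≡ 0
∑-zero []       f≗0 = refl
∑-zero (x ∷ xs) f≗0 = cong₂ ℕ._+_ (f≗0 x) (∑-zero xs f≗0)

∑-*ˡ : ∀ {A : Set} (xs : List A) (f : A → ℕ) c → ∑ xs (λ x → c ℕ.* f x) ≡ c ℕ.* ∑ xs f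
∑-*ˡ []       f c = sym (ℕ.*-zeroʳ c)
∑-*ˡ (x ∷ xs) f c = trans (cong (c ℕ.* f x ℕ.+_) (∑-*ˡ xs f c)) (sym (ℕ.*-distribˡ-+ c (f x) (∑ xs f)))

does-sound : ∀ {A : Set} (a? : Dec A) → T (does a?) → A
does-sound (yes a) _ = a

does-complete : ∀ {A : Set} (a? : Dec A) → A → T (does a?)
does-complete (yes _) _ = _
does-complete (no ¬a) a = contradiction a ¬a

-- The Boolean lattice

∑-subsets-suc : ∀ n (f : Subset (suc n) → ℕ) →
  ∑ (subsets (suc n)) f ≡ ∑ (subsets n) (f ∘ (inside ∷_)) ℕ.+ ∑ (subsets n) (f ∘ (outside ∷_))
∑-subsets-suc n f = begin
  ListAction.sum (map f (map (inside ∷_) (subsets n) ++ map (outside ∷_) (subsets n)))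
    ≡⟨ cong ListAction.sum (map-++ f (map (inside ∷_) (subsets n)) _) ⟩
  ListAction.sum (map f (map (inside ∷_) (subsets n)) ++ map f (map (outside ∷_) (subsets n)))
    ≡⟨ sum-++ (map f (map (inside ∷_) (subsets n))) _ ⟩
  ∑ (map (inside ∷_) (subsets n)) f ℕ.+ ∑ (map (outside ∷_) (subsets n)) f
    ≡⟨ cong₂ ℕ._+_ (cong ListAction.sum (map-∘ (subsets n))) (cong ListAction.sum (map-∘ (subsets n))) ⟨
  ∑ (subsets n) (f ∘ (inside ∷_)) ℕ.+ ∑ (subsets n) (f ∘ (outside ∷_)) ∎

-- The binomial theorem: each element of `x` is either taken, with weight `r`, or left out, with
-- weight one.
∑-⊆-power : ∀ {n} r (x : Subset n) →
  ∑ (subsets n) (λ y → if does (y ⊆? x) then r ^ ∣ y ∣ else 0) ≡ suc r ^ ∣ x ∣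
∑-⊆-power r [] = refl
∑-⊆-power {suc n} r (inside ∷ x) = begin
  ∑ (subsets (suc n)) (λ y → if does (y ⊆? (inside ∷ x)) then r ^ ∣ y ∣ else 0)
    ≡⟨ ∑-subsets-suc n _ ⟩
  ∑ (subsets n) (λ y → if does (y ⊆? x) then r ℕ.* r ^ ∣ y ∣ else 0) ℕ.+ p
    ≡⟨ cong (ℕ._+ p) (trans (∑-cong (subsets n) λ y → if-* (does (y ⊆? x)) (r ^ ∣ y ∣)) (∑-*ˡ (subsets n) _ r)) ⟩
  r ℕ.* p ℕ.+ p
    ≡⟨ ℕ.+-comm (r ℕ.* p) p ⟩
  suc r ℕ.* p
    ≡⟨ cong (suc r ℕ.*_) (∑-⊆-power r x) ⟩
  suc r ^ suc ∣ x ∣ ∎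
  where
  p = ∑ (subsets n) (λ y → if does (y ⊆? x) then r ^ ∣ y ∣ else 0)
  if-* : ∀ b k → (if b then r ℕ.* k else 0) ≡ r ℕ.* (if b then k else 0)
  if-* true  k = refl
  if-* false k = sym (ℕ.*-zeroʳ r)
∑-⊆-power {suc n} r (outside ∷ x) = begin
  ∑ (subsets (suc n)) (λ y → if does (y ⊆? (outside ∷ x)) then r ^ ∣ y ∣ else 0)
    ≡⟨ ∑-subsets-suc n _ ⟩
  ∑ (subsets n) (λ y → 0) ℕ.+ ∑ (subsets n) (λ y → if does (y ⊆? x) then r ^ ∣ y ∣ else 0)
    ≡⟨ cong₂ ℕ._+_ (∑-zero (subsets n) λ _ → refl) (∑-⊆-power r x) ⟩
  suc r ^ ∣ x ∣ ∎

nonempty-inside : ∀ {n} (y : Subset n) → does (nonempty? (inside ∷ y)) ≡ true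
nonempty-inside y = dec-true (nonempty? (inside ∷ y)) (zero , here)

nonempty-outside : ∀ {n} (y : Subset n) → does (nonempty? (outside ∷ y)) ≡ does (nonempty? y)
nonempty-outside y = does-⇔ (mk⇔ (λ { (suc i , there i∈y) → i , i∈y }) (λ { (i , i∈y) → suc i , there i∈y }))
                            (nonempty? (outside ∷ y)) (nonempty? y)

∑-subsets-nonempty : ∀ n (f : Subset n → ℕ) →
  ∑ (subsets n) f ≡ f ∅ ℕ.+ ∑ (subsets n) (λ y → if does (nonempty? y) then f y else 0)
∑-subsets-nonempty zero    f = refl
∑-subsets-nonempty (suc n) f = begin
  ∑ (subsets (suc n)) f
    ≡⟨ ∑-subsets-suc n f ⟩
  a ℕ.+ ∑ (subsets n) (f ∘ (outside ∷_))
    ≡⟨ cong (a ℕ.+_) (∑-subsets-nonempty n (f ∘ (outside ∷_))) ⟩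
  a ℕ.+ (f ∅ ℕ.+ ∑ (subsets n) (λ y → if does (nonempty? y) then f (outside ∷ y) else 0))
    ≡⟨ solve 3 (λ a b c → a :+ (b :+ c) := b :+ (a :+ c)) refl a (f ∅) _ ⟩
  f ∅ ℕ.+ (a ℕ.+ ∑ (subsets n) (λ y → if does (nonempty? y) then f (outside ∷ y) else 0))
    ≡⟨ cong (f ∅ ℕ.+_) (cong₂ ℕ._+_
         (∑-cong (subsets n) λ y → cong (λ b → if b then f (inside ∷ y) else 0) (nonempty-inside y))
         (∑-cong (subsets n) λ y → cong (λ b → if b then f (outside ∷ y) else 0) (nonempty-outside y))) ⟨
  f ∅ ℕ.+ (∑ (subsets n) (λ y → if does (nonempty? (inside ∷ y)) then f (inside ∷ y) else 0) ℕ.+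
           ∑ (subsets n) (λ y → if does (nonempty? (outside ∷ y)) then f (outside ∷ y) else 0))
    ≡⟨ cong (f ∅ ℕ.+_) (∑-subsets-suc n _) ⟨
  f ∅ ℕ.+ ∑ (subsets (suc n)) (λ y → if does (nonempty? y) then f y else 0) ∎
  where
  open ℕSolver.+-*-Solver using (solve; con; _:+_; _:=_)
  a = ∑ (subsets n) (f ∘ (inside ∷_))

nonempty⇒0<∣∣ : ∀ {n} {x : Subset n} → Nonempty x → 0 < ∣ x ∣
nonempty⇒0<∣∣ {x = inside  ∷ x} _                     = s≤s z≤n
nonempty⇒0<∣∣ {x = outside ∷ x} (suc i , there i∈x) = nonempty⇒0<∣∣ (i , i∈x)

-- Strict inclusion asks for a witness outside `x`; its decidability turns the negative hypothesis
-- into one.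
⊆∧⊉⇒∣∣<∣∣ : ∀ {n} {x y : Subset n} → x ⊆ y → ¬ (y ⊆ x) → ∣ x ∣ < ∣ y ∣
⊆∧⊉⇒∣∣<∣∣ {x = x} {y} x⊆y y⊈x with x ⊂? y
... | yes x⊂y = p⊂q⇒∣p∣<∣q∣ x⊂y
... | no  x⊄y = contradiction
  (λ {i} i∈y → decidable-stable (i ∈? x) λ i∉x → x⊄y (x⊆y , i , i∈y , i∉x)) y⊈x

-- Of two comparable entries the larger comes first, and no entry repeats, so a chain read from left
-- to right decreases strictly.
Descending : ∀ {n} → List (Subset n) → Set
Descending = AllPairs (λ x y → ¬ (x ⊆ y))

-- Sets containing the new element are listed first, and none of them lies inside a set that omits
-- it.
subsets-descending : ∀ n → Descending (subsets n)
subsets-descending zero    = [] ∷ []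
subsets-descending (suc n) = AllPairs⁺.++⁺
  (AllPairs⁺.map⁺ (AllPairs.map (_∘ drop-∷-⊆) (subsets-descending n)))
  (AllPairs⁺.map⁺ (AllPairs.map (_∘ drop-∷-⊆) (subsets-descending n)))
  (All⁺.map⁺ (All.universal (λ x → All⁺.map⁺ (All.universal (λ y in∷x⊆out∷y → case in∷x⊆out∷y here of λ ()) (subsets n))) (subsets n)))

-- Weighted sums over chains

-- Sum of w ∣C∣ over the chains C in a descending list whose members satisfy Q.
chainSum : ∀ {n} → (ℕ → ℕ) → (Subset n → Bool) → List (Subset n) → ℕ
chainSum w Q []       = w 0
chainSum w Q (x ∷ xs) =
  chainSum w Q xs ℕ.+ (if Q x then chainSum (w ∘ suc) (λ y → Q y ∧ does (y ⊆? x)) xs else 0)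

module _ {n : ℕ} where

  chainSum-congʷ : ∀ {v w} (Q : Subset n → Bool) xs → (∀ k → v k ≡ w k) → chainSum v Q xs ≡ chainSum w Q xs
  chainSum-congʷ Q []       v≗w = v≗w 0
  chainSum-congʷ Q (x ∷ xs) v≗w = cong₂ ℕ._+_ (chainSum-congʷ Q xs v≗w)
    (cong (if Q x then_else 0) (chainSum-congʷ _ xs (v≗w ∘ suc)))

  chainSum-cong : ∀ w {P Q : Subset n → Bool} xs → (∀ x → P x ≡ Q x) → chainSum w P xs ≡ chainSum w Q xs
  chainSum-cong w         []       P≗Q = refl
  chainSum-cong w {P} {Q} (x ∷ xs) P≗Q = cong₂ ℕ._+_ (chainSum-cong w xs P≗Q)
    (cong₂ (if_then_else 0) (P≗Q x) (chainSum-cong (w ∘ suc) xs λ y → cong (_∧ does (y ⊆? x)) (P≗Q y)))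

  chainSum-+ : ∀ v w (Q : Subset n → Bool) xs →
    chainSum (λ k → v k ℕ.+ w k) Q xs ≡ chainSum v Q xs ℕ.+ chainSum w Q xs
  chainSum-+ v w Q []       = refl
  chainSum-+ v w Q (x ∷ xs) = trans
    (cong₂ ℕ._+_ (chainSum-+ v w Q xs) (cong (if Q x then_else 0) (chainSum-+ (v ∘ suc) (w ∘ suc) _ xs)))
    (interchange (Q x) (chainSum v Q xs) (chainSum w Q xs) (chainSum (v ∘ suc) _ xs) (chainSum (w ∘ suc) _ xs))
    where
    open ℕSolver.+-*-Solver using (solve; con; _:+_; _:=_)
    interchange : ∀ q a b c d → a ℕ.+ b ℕ.+ (if q then c ℕ.+ d else 0)
                    ≡ a ℕ.+ (if q then c else 0) ℕ.+ (b ℕ.+ (if q then d else 0))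
    interchange true  a b c d = solve 4 (λ a b c d → a :+ b :+ (c :+ d) := a :+ c :+ (b :+ d)) refl a b c d
    interchange false a b c d = solve 2 (λ a b → a :+ b :+ con 0 := a :+ con 0 :+ (b :+ con 0)) refl a b

  chainSum-zero : ∀ w (Q : Subset n → Bool) xs → (∀ k → w k ≡ 0) → chainSum w Q xs ≡ 0
  chainSum-zero w Q []       w≗0 = w≗0 0
  chainSum-zero w Q (x ∷ xs) w≗0 = cong₂ ℕ._+_ (chainSum-zero w Q xs w≗0)
    (trans (cong (if Q x then_else 0) (chainSum-zero (w ∘ suc) _ xs (w≗0 ∘ suc))) (if-eta (Q x)))

  -- Only the empty chain has nonzero weight.
  chainSum-0C : ∀ (Q : Subset n → Bool) xs → chainSum (0 C_) Q xs ≡ 1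
  chainSum-0C Q []       = refl
  chainSum-0C Q (x ∷ xs) = cong₂ ℕ._+_ (chainSum-0C Q xs)
    (trans (cong (if Q x then_else 0) (chainSum-zero _ _ xs λ k → k>n⇒nCk≡0 {0} {suc k} (s≤s z≤n))) (if-eta (Q x)))

  chainSum-filter : ∀ w (Q : Subset n → Bool) {P : Pred (Subset n) 0ℓ} (P? : Decidable P) xs →
    chainSum w Q (filter P? xs) ≡ chainSum w (λ x → does (P? x) ∧ Q x) xs
  chainSum-filter w Q P? []       = refl
  chainSum-filter w Q P? (x ∷ xs) with does (P? x)
  ... | true  = cong₂ ℕ._+_ (chainSum-filter w Q P? xs) (cong (if Q x then_else 0)
    (trans (chainSum-filter (w ∘ suc) _ P? xs) (chainSum-cong (w ∘ suc) xs λ y → sym (∧-assoc (does (P? y)) (Q y) _))))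
  ... | false = trans (chainSum-filter w Q P? xs) (sym (ℕ.+-identityʳ _))

  -- Pascal's rule splits off the largest element of a chain.
  chainSum-pascal : ∀ r (Q : Subset n → Bool) {xs} → Descending xs →
    chainSum (suc r C_) Q xs
      ≡ suc (∑ xs λ x → if Q x then chainSum (r C_) (λ y → Q y ∧ does (y ⊆? x)) xs else 0)
  chainSum-pascal r Q []                     = refl
  chainSum-pascal r Q {x ∷ xs} (x⊈xs ∷ desc) = begin
    chainSum (suc r C_) Q xs ℕ.+ (if Q x then chainSum (λ k → suc r C suc k) (Q ∧⊆ x) xs else 0)
      ≡⟨ cong₂ ℕ._+_ (chainSum-pascal r Q desc) (head-term (Q x) refl) ⟩
    suc (∑ xs λ y → if Q y then chainSum (r C_) (Q ∧⊆ y) xs else 0)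
      ℕ.+ (if Q x then chainSum (r C_) (Q ∧⊆ x) (x ∷ xs) else 0)
      ≡⟨ cong suc (trans (ℕ.+-comm _ (if Q x then chainSum (r C_) (Q ∧⊆ x) (x ∷ xs) else 0))
           (cong ((if Q x then chainSum (r C_) (Q ∧⊆ x) (x ∷ xs) else 0) ℕ.+_)
                 (∑-cong-All (All.map (λ {y} x⊈y → cong (if Q y then_else 0) (tail-term y x⊈y)) x⊈xs)))) ⟩
    suc (∑ (x ∷ xs) λ y → if Q y then chainSum (r C_) (Q ∧⊆ y) (x ∷ xs) else 0) ∎
    where
    _∧⊆_ : (Subset n → Bool) → Subset n → Subset n → Bool
    (P ∧⊆ x) y = P y ∧ does (y ⊆? x)

    -- For chains with largest element `x`, Pascal's rule splits the weight in two. The part with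
    -- `r C suc k` counts again the chains through `x`, which puts `x` back into the list.
    head-term : ∀ q → Q x ≡ q →
      (if q then chainSum (λ k → suc r C suc k) (Q ∧⊆ x) xs else 0)
        ≡ (if q then chainSum (r C_) (Q ∧⊆ x) (x ∷ xs) else 0)
    head-term false _    = refl
    head-term true  Qx≡t = begin
      chainSum (λ k → suc r C suc k) (Q ∧⊆ x) xs
        ≡⟨ chainSum-congʷ (Q ∧⊆ x) xs (λ k → nCk+nC[k+1]≡[n+1]C[k+1] r k) ⟨
      chainSum (λ k → r C k ℕ.+ r C suc k) (Q ∧⊆ x) xs
        ≡⟨ chainSum-+ (r C_) (λ k → r C suc k) (Q ∧⊆ x) xs ⟩
      chainSum (r C_) (Q ∧⊆ x) xs ℕ.+ chainSum (λ k → r C suc k) (Q ∧⊆ x) xs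
        ≡⟨ cong (chainSum (r C_) (Q ∧⊆ x) xs ℕ.+_) (chainSum-cong _ xs λ y →
             trans (∧-assoc (Q y) _ _) (cong (Q y ∧_) (∧-idem (does (y ⊆? x))))) ⟨
      chainSum (r C_) (Q ∧⊆ x) xs ℕ.+ chainSum (λ k → r C suc k) ((Q ∧⊆ x) ∧⊆ x) xs
        ≡⟨ cong (λ b → chainSum (r C_) (Q ∧⊆ x) xs ℕ.+ (if b then chainSum (λ k → r C suc k) ((Q ∧⊆ x) ∧⊆ x) xs else 0))
             (cong₂ _∧_ Qx≡t (dec-true (x ⊆? x) ⊆-refl)) ⟨
      chainSum (r C_) (Q ∧⊆ x) (x ∷ xs) ∎

    -- Since `x` is not contained in `y`, it belongs to no chain below `y`.
    tail-term : ∀ y → ¬ (x ⊆ y) → chainSum (r C_) (Q ∧⊆ y) xs ≡ chainSum (r C_) (Q ∧⊆ y) (x ∷ xs)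
    tail-term y x⊈y = trans (sym (ℕ.+-identityʳ _)) (cong (λ b → chainSum (r C_) (Q ∧⊆ y) xs ℕ.+
      (if b then chainSum (λ k → r C suc k) ((Q ∧⊆ y) ∧⊆ x) xs else 0))
      (sym (trans (cong (Q x ∧_) (dec-false (x ⊆? y) x⊈y)) (∧-zeroʳ (Q x)))))

  -- Induction on `r`. After the largest element `x` is split off, the induction hypothesis for the
  -- sets below `x` gives one plus the sum of r^|y| over nonempty y ⊆ x. The one is the term of the
  -- empty set, so the total is (1+r)^|x|. For `r = 0` every term of the sum vanishes because `x` is
  -- nonempty.
  chainSum-power : ∀ r (Q : Subset n → Bool) →
    (∀ {x} → T (Q x) → Nonempty x) → (∀ {x y} → T (Q x) → y ⊆ x → Nonempty y → T (Q y)) →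
    chainSum (r C_) Q (subsets n) ≡ suc (∑ (subsets n) λ x → if Q x then r ^ ∣ x ∣ else 0)
  chainSum-power zero Q Q⇒nonempty down =
    trans (chainSum-0C Q (subsets n)) (cong suc (sym (∑-zero (subsets n) λ x → vanish x (Q x) refl)))
    where
    vanish : ∀ x q → Q x ≡ q → (if q then 0 ^ ∣ x ∣ else 0) ≡ 0
    vanish x false _    = refl
    vanish x true  Qx≡t with ∣ x ∣ | nonempty⇒0<∣∣ (Q⇒nonempty (subst T (sym Qx≡t) _))
    ... | suc _ | _ = refl
  chainSum-power (suc r) Q Q⇒nonempty down = trans
    (chainSum-pascal r Q (subsets-descending n))
    (cong suc (∑-cong (subsets n) λ x → below x (Q x) refl))
    where
    below : ∀ x q → Q x ≡ q →
      (if q then chainSum (r C_) (λ y → Q y ∧ does (y ⊆? x)) (subsets n) else 0) ≡ (if q then suc r ^ ∣ x ∣ else 0)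
    below x false _    = refl
    below x true  Qx≡t = begin
      chainSum (r C_) (λ y → Q y ∧ does (y ⊆? x)) (subsets n)
        ≡⟨ chainSum-power r _ (λ {y} → Q⇒nonempty ∘ splitˡ y)
             (λ {y} {z} Qy∧y⊆x z⊆y z≢∅ → from T-∧
               (down (splitˡ y Qy∧y⊆x) z⊆y z≢∅ , does-complete (z ⊆? x) (⊆-trans z⊆y (splitʳ y Qy∧y⊆x)))) ⟩
      suc (∑ (subsets n) λ y → if Q y ∧ does (y ⊆? x) then r ^ ∣ y ∣ else 0)
        ≡⟨ cong suc (∑-cong (subsets n) nonempty-below) ⟩
      suc (∑ (subsets n) λ y → if does (nonempty? y) then (if does (y ⊆? x) then r ^ ∣ y ∣ else 0) else 0)
        ≡⟨ cong (ℕ._+ ∑ (subsets n) λ y → if does (nonempty? y) then (if does (y ⊆? x) then r ^ ∣ y ∣ else 0) else 0)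
             (trans (cong (λ b → if b then r ^ ∣ ∅ {n} ∣ else 0) (dec-true (∅ ⊆? x) ⊥⊆)) (cong (r ^_) (∣⊥∣≡0 n))) ⟨
      (if does (∅ ⊆? x) then r ^ ∣ ∅ {n} ∣ else 0)
        ℕ.+ (∑ (subsets n) λ y → if does (nonempty? y) then (if does (y ⊆? x) then r ^ ∣ y ∣ else 0) else 0)
        ≡⟨ ∑-subsets-nonempty n (λ y → if does (y ⊆? x) then r ^ ∣ y ∣ else 0) ⟨
      ∑ (subsets n) (λ y → if does (y ⊆? x) then r ^ ∣ y ∣ else 0)
        ≡⟨ ∑-⊆-power r x ⟩
      suc r ^ ∣ x ∣ ∎
      where
      Qx : T (Q x)
      Qx = subst T (sym Qx≡t) _

      splitˡ : ∀ y → T (Q y ∧ does (y ⊆? x)) → T (Q y)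
      splitˡ y = proj₁ ∘ to T-∧

      splitʳ : ∀ y → T (Q y ∧ does (y ⊆? x)) → y ⊆ x
      splitʳ y Qy∧y⊆x = does-sound (y ⊆? x) (proj₂ (to (T-∧ {Q y}) Qy∧y⊆x))

      nonempty-below-⇔ : ∀ y → T (Q y ∧ does (y ⊆? x)) ⇔ (Nonempty y × y ⊆ x)
      nonempty-below-⇔ y = mk⇔ separate join
        where
        separate : T (Q y ∧ does (y ⊆? x)) → Nonempty y × y ⊆ x
        separate Qy∧y⊆x = Q⇒nonempty (splitˡ y Qy∧y⊆x) , splitʳ y Qy∧y⊆x

        join : Nonempty y × y ⊆ x → T (Q y ∧ does (y ⊆? x))
        join (y≢∅ , y⊆x) = from T-∧ (down Qx y⊆x y≢∅ , does-complete (y ⊆? x) y⊆x)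

      nonempty-below : ∀ y → (if Q y ∧ does (y ⊆? x) then r ^ ∣ y ∣ else 0)
        ≡ (if does (nonempty? y) then (if does (y ⊆? x) then r ^ ∣ y ∣ else 0) else 0)
      nonempty-below y = trans
        (cong (λ b → if b then r ^ ∣ y ∣ else 0)
          (does-⇔ (nonempty-below-⇔ y) (T? (Q y ∧ does (y ⊆? x))) (nonempty? y ×-dec (y ⊆? x))))
        (if-∧ (does (nonempty? y)))

  -- Chains as sets of positions

  -- At `nonemptyFaces Δ` this is by definition the face predicate of `barycentric Δ`.
  IsChain : ∀ (xs : List (Subset n)) → Subset (length xs) → Set
  IsChain xs σ = ∀ k l → k ∈ σ → l ∈ σ → lookup xs k ⊆ lookup xs l ⊎ lookup xs l ⊆ lookup xs k

  -- The recursion copies that of `chainSum`: a chosen entry restricts all later ones to its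
  -- subsets.
  chainᵇ : (Subset n → Bool) → (xs : List (Subset n)) → Subset (length xs) → Bool
  chainᵇ Q []       []            = true
  chainᵇ Q (x ∷ xs) (outside ∷ σ) = chainᵇ Q xs σ
  chainᵇ Q (x ∷ xs) (inside ∷ σ)  = Q x ∧ chainᵇ (λ y → Q y ∧ does (y ⊆? x)) xs σ

  ∑-chainᵇ : ∀ w Q xs → ∑ (subsets (length xs)) (λ σ → if chainᵇ Q xs σ then w ∣ σ ∣ else 0) ≡ chainSum w Q xs
  ∑-chainᵇ w Q []       = ℕ.+-identityʳ (w 0)
  ∑-chainᵇ w Q (x ∷ xs) = begin
    ∑ (subsets (suc (length xs))) (λ σ → if chainᵇ Q (x ∷ xs) σ then w ∣ σ ∣ else 0)
      ≡⟨ ∑-subsets-suc (length xs) _ ⟩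
    ∑ (subsets (length xs)) (λ σ → if Q x ∧ chainᵇ _ xs σ then w (suc ∣ σ ∣) else 0) ℕ.+
    ∑ (subsets (length xs)) (λ σ → if chainᵇ Q xs σ then w ∣ σ ∣ else 0)
      ≡⟨ cong₂ ℕ._+_ (inside-part (Q x)) (∑-chainᵇ w Q xs) ⟩
    (if Q x then chainSum (w ∘ suc) _ xs else 0) ℕ.+ chainSum w Q xs
      ≡⟨ ℕ.+-comm _ (chainSum w Q xs) ⟩
    chainSum w Q (x ∷ xs) ∎
    where
    inside-part : ∀ q → ∑ (subsets (length xs)) (λ σ → if q ∧ chainᵇ (λ y → Q y ∧ does (y ⊆? x)) xs σ then w (suc ∣ σ ∣) else 0)
      ≡ (if q then chainSum (w ∘ suc) (λ y → Q y ∧ does (y ⊆? x)) xs else 0)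
    inside-part true  = ∑-chainᵇ (w ∘ suc) _ xs
    inside-part false = ∑-zero (subsets (length xs)) λ _ → refl

  -- The two conclusions are proved together: membership in the strengthened predicate is what makes
  -- later entries comparable with the head.
  chainᵇ-sound : ∀ Q xs σ → T (chainᵇ Q xs σ) → (∀ k → k ∈ σ → T (Q (lookup xs k))) × IsChain xs σ
  chainᵇ-sound Q []       []            _  = (λ ()) , λ ()
  chainᵇ-sound Q (x ∷ xs) (outside ∷ σ) ch =
    let (Qσ , chain) = chainᵇ-sound Q xs σ ch in
    (λ { (suc k) (there k∈C) → Qσ k k∈C }) ,
    (λ { (suc k) (suc l) (there k∈C) (there l∈C) → chain k l k∈C l∈C })
  chainᵇ-sound Q (x ∷ xs) (inside ∷ σ) ch = members , chain
    where
    Q′ : Subset n → Bool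
    Q′ y = Q y ∧ does (y ⊆? x)

    ih : (∀ k → k ∈ σ → T (Q′ (lookup xs k))) × IsChain xs σ
    ih = chainᵇ-sound Q′ xs σ (proj₂ (to (T-∧ {Q x}) ch))

    below : ∀ k → k ∈ σ → lookup xs k ⊆ x
    below k k∈σ = does-sound (lookup xs k ⊆? x) (proj₂ (to (T-∧ {Q (lookup xs k)}) (proj₁ ih k k∈σ)))

    members : ∀ k → k ∈ inside ∷ σ → T (Q (lookup (x ∷ xs) k))
    members zero    here        = proj₁ (to T-∧ ch)
    members (suc k) (there k∈σ) = proj₁ (to T-∧ (proj₁ ih k k∈σ))

    chain : IsChain (x ∷ xs) (inside ∷ σ)
    chain zero    zero    here        here        = inj₁ ⊆-refl
    chain zero    (suc l) here        (there l∈σ) = inj₂ (below l l∈σ)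
    chain (suc k) zero    (there k∈σ) here        = inj₁ (below k k∈σ)
    chain (suc k) (suc l) (there k∈σ) (there l∈σ) = proj₂ ih k l k∈σ l∈σ

  -- In a descending list, an entry comparable with an earlier `x` must be a subset of `x`, which is
  -- what `chainᵇ` tests.
  chainᵇ-complete : ∀ Q {xs} → Descending xs → ∀ σ →
    (∀ k → k ∈ σ → T (Q (lookup xs k))) → IsChain xs σ → T (chainᵇ Q xs σ)
  chainᵇ-complete Q []           []            Qσ chain = _
  chainᵇ-complete Q (_ ∷ desc)   (outside ∷ σ) Qσ chain =
    chainᵇ-complete Q desc σ (λ k → Qσ (suc k) ∘ there) λ k l k∈C l∈C → chain (suc k) (suc l) (there k∈C) (there l∈C)
  chainᵇ-complete Q {x ∷ xs} (x⊈xs ∷ desc) (inside ∷ σ) Qσ chain = from T-∧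
    ( Qσ zero here
    , chainᵇ-complete _ desc σ
        (λ k k∈C → from T-∧ (Qσ (suc k) (there k∈C) , does-complete (lookup xs k ⊆? x) (below k (chain zero (suc k) here (there k∈C)))))
        (λ k l k∈C l∈C → chain (suc k) (suc l) (there k∈C) (there l∈C)))
    where
    below : ∀ k → x ⊆ lookup xs k ⊎ lookup xs k ⊆ x → lookup xs k ⊆ x
    below k (inj₁ x⊆y) = contradiction (λ {i} → x⊆y {i}) (All.lookup x⊈xs (∈-lookup k))
    below k (inj₂ y⊆x) = y⊆x

  -- Sizes fall strictly along a chain. Once `x` is chosen, its own size replaces `e` as the strict
  -- bound for the rest, and it is positive because `x` is nonempty.
  chainᵇ-∣∣< : ∀ Q {xs} → Descending xs → All Nonempty xs → ∀ {e} → 0 < e →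
    All (λ x → T (Q x) → ∣ x ∣ < e) xs → ∀ σ → T (chainᵇ Q xs σ) → ∣ σ ∣ < e
  chainᵇ-∣∣< Q []         []           0<e []            []            _  = 0<e
  chainᵇ-∣∣< Q (_ ∷ desc) (_ ∷ xs≢∅)   0<e (_ ∷ bound)   (outside ∷ σ) ch = chainᵇ-∣∣< Q desc xs≢∅ 0<e bound σ ch
  chainᵇ-∣∣< Q {x ∷ xs} (x⊈xs ∷ desc) (x≢∅ ∷ xs≢∅) 0<e (x-bound ∷ _) (inside ∷ σ) ch =
    let (Qx , ch′) = to T-∧ ch in
    ℕ.<-≤-trans (s≤s (chainᵇ-∣∣< _ desc xs≢∅ (nonempty⇒0<∣∣ x≢∅)
      (All.map (λ {y} x⊈y Qy∧y⊆x → ⊆∧⊉⇒∣∣<∣∣ (does-sound (y ⊆? x) (proj₂ (to (T-∧ {Q y}) Qy∧y⊆x))) x⊈y) x⊈xs) σ ch′)) (x-bound Qx)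

-- Face numbers

length-filter-∷ : ∀ {A : Set} {P : Pred A 0ℓ} (P? : Decidable P) x xs →
  length (filter P? (x ∷ xs)) ≡ (if does (P? x) then 1 else 0) ℕ.+ length (filter P? xs)
length-filter-∷ P? x xs with does (P? x)
... | true  = refl
... | false = refl

∑-delta : ∀ n k (f : ℕ → ℚ) → k < n → sum {n} (λ i → fromℕ (if k ≡ᵇ toℕ i then 1 else 0) * f (toℕ i)) ≡ f k
∑-delta (suc n) zero    f _         = trans
  (cong₂ _+_ (ℚ.*-identityˡ (f 0)) (sum-zero n λ i → ℚ.*-zeroˡ (f (suc (toℕ i))))) (ℚ.+-identityʳ (f 0))
∑-delta (suc n) (suc k) f (s≤s k<n) = trans
  (cong₂ _+_ (ℚ.*-zeroˡ (f 0)) (∑-delta n k (f ∘ suc) k<n)) (ℚ.+-identityˡ (f (suc k)))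

-- Each `x` satisfying `P` contributes at the single index `i = size x`, which the bound by `d`
-- keeps in range.
∑-by-size : ∀ {A : Set} {P : Pred A 0ℓ} (P? : Decidable P) (w : ℕ → ℕ) (size : A → ℕ) d →
  (∀ x → P x → size x ≤ d) → ∀ xs →
  sum {suc d} (λ i → fromℕ (length (filter (λ x → P? x ×-dec (size x ℕ.≟ toℕ i)) xs)) * fromℕ (w (toℕ i)))
    ≡ fromℕ (∑ xs λ x → if does (P? x) then w (size x) else 0)
∑-by-size P? w size d bound []       = sum-zero (suc d) λ i → ℚ.*-zeroˡ (fromℕ (w (toℕ i)))
∑-by-size {P = P} P? w size d bound (x ∷ xs) = begin
  sum {suc d} (λ i → fromℕ (count (x ∷ xs) (toℕ i)) * fromℕ (w (toℕ i)))
    ≡⟨ sum-cong-≗ {suc d} (λ i → trans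
         (cong (_* fromℕ (w (toℕ i))) (trans (cong fromℕ (length-filter-∷ (λ x → P? x ×-dec (size x ℕ.≟ toℕ i)) x xs))
           (fromℕ-+ (δ (does (P? x)) (toℕ i)) (count xs (toℕ i)))))
         (ℚ.*-distribʳ-+ (fromℕ (w (toℕ i))) (fromℕ (δ (does (P? x)) (toℕ i))) (fromℕ (count xs (toℕ i))))) ⟩
  sum {suc d} (λ i → fromℕ (δ (does (P? x)) (toℕ i)) * fromℕ (w (toℕ i)) + fromℕ (count xs (toℕ i)) * fromℕ (w (toℕ i)))
    ≡⟨ ∑-distrib-+ {suc d} (λ i → fromℕ (δ (does (P? x)) (toℕ i)) * fromℕ (w (toℕ i))) (λ i → fromℕ (count xs (toℕ i)) * fromℕ (w (toℕ i))) ⟩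
  sum {suc d} (λ i → fromℕ (δ (does (P? x)) (toℕ i)) * fromℕ (w (toℕ i))) + sum {suc d} (λ i → fromℕ (count xs (toℕ i)) * fromℕ (w (toℕ i)))
    ≡⟨ cong₂ _+_ (by-cases (P? x)) (∑-by-size P? w size d bound xs) ⟩
  fromℕ (if does (P? x) then w (size x) else 0) + fromℕ (∑ xs λ x → if does (P? x) then w (size x) else 0)
    ≡⟨ fromℕ-+ (if does (P? x) then w (size x) else 0) _ ⟨
  fromℕ (∑ (x ∷ xs) λ x → if does (P? x) then w (size x) else 0) ∎
  where
  count : List _ → ℕ → ℕ
  count ys i = length (filter (λ x → P? x ×-dec (size x ℕ.≟ i)) ys)

  δ : Bool → ℕ → ℕ
  δ b i = if b ∧ (size x ≡ᵇ i) then 1 else 0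

  by-cases : (p : Dec (P x)) → sum {suc d} (λ i → fromℕ (δ (does p) (toℕ i)) * fromℕ (w (toℕ i)))
    ≡ fromℕ (if does p then w (size x) else 0)
  by-cases (yes px) = ∑-delta (suc d) (size x) (fromℕ ∘ w) (s≤s (bound x px))
  by-cases (no  _)  = sum-zero (suc d) λ i → ℚ.*-zeroˡ (fromℕ (w (toℕ i)))

∑-faceCount : ∀ Δ d (w : ℕ → ℕ) → (∀ S → Face Δ S → ∣ S ∣ ≤ d) →
  sum {suc d} (λ i → fromℕ (faceCount Δ (toℕ i)) * fromℕ (w (toℕ i)))
    ≡ fromℕ (∑ (subsets (size Δ)) λ S → if does (face? Δ S) then w ∣ S ∣ else 0)
∑-faceCount Δ d w bound = ∑-by-size (face? Δ) w ∣_∣ d bound (subsets (size Δ))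

-- Barycentric subdivision

nonemptyFaces-descending : ∀ Δ → Descending (nonemptyFaces Δ)
nonemptyFaces-descending Δ = AllPairs⁺.filter⁺ _ (subsets-descending (size Δ))

-- The strict bound `suc d` on the sizes of faces also bounds the lengths of chains.
barycentric-bound : ∀ Δ d → (∀ S → Face Δ S → ∣ S ∣ ≤ d) → ∀ σ → Face (barycentric Δ) σ → ∣ σ ∣ ≤ d
barycentric-bound Δ d bound σ chain = ℕ.≤-pred (chainᵇ-∣∣< (λ _ → true) (nonemptyFaces-descending Δ)
  (All.map proj₂ faces) (s≤s z≤n) (All.map (λ (face , _) _ → s≤s (bound _ face)) faces) σ
  (chainᵇ-complete (λ _ → true) (nonemptyFaces-descending Δ) σ (λ _ _ → _) chain))
  where
  faces : All (λ S → Face Δ S × Nonempty S) (nonemptyFaces Δ)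
  faces = All⁺.all-filter _ (subsets (size Δ))

-- `chainSum-power` applies because the nonempty faces are closed under passing to nonempty subsets;
-- its leading one is the term of the empty face.
∑-barycentric : ∀ r Δ →
  ∑ (subsets (size (barycentric Δ))) (λ σ → if does (face? (barycentric Δ) σ) then r C ∣ σ ∣ else 0)
    ≡ ∑ (subsets (size Δ)) (λ S → if does (face? Δ S) then r ^ ∣ S ∣ else 0)
∑-barycentric r Δ = begin
  ∑ (subsets (length L)) (λ σ → if does (face? (barycentric Δ) σ) then r C ∣ σ ∣ else 0)
    ≡⟨ ∑-cong (subsets (length L)) (λ σ → cong (λ b → if b then r C ∣ σ ∣ else 0) (face≡chainᵇ σ)) ⟩
  ∑ (subsets (length L)) (λ σ → if chainᵇ (λ _ → true) L σ then r C ∣ σ ∣ else 0)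
    ≡⟨ ∑-chainᵇ (r C_) (λ _ → true) L ⟩
  chainSum (r C_) (λ _ → true) L
    ≡⟨ chainSum-filter (r C_) (λ _ → true) P? (subsets (size Δ)) ⟩
  chainSum (r C_) (λ S → does (P? S) ∧ true) (subsets (size Δ))
    ≡⟨ chainSum-cong (r C_) (subsets (size Δ)) (λ S → ∧-identityʳ (does (P? S))) ⟩
  chainSum (r C_) (does ∘ P?) (subsets (size Δ))
    ≡⟨ chainSum-power r (does ∘ P?) (λ {S} → proj₂ ∘ does-sound (P? S))
         (λ {S} {S′} PS S′⊆S S′≢∅ → does-complete (P? S′) (down Δ S′⊆S (proj₁ (does-sound (P? S) PS)) , S′≢∅)) ⟩
  suc (∑ (subsets (size Δ)) λ S → if does (P? S) then r ^ ∣ S ∣ else 0)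
    ≡⟨ cong₂ ℕ._+_ (cong₂ (λ b k → if b then r ^ k else 0) (dec-true (face? Δ ∅) (∅-face Δ)) (∣⊥∣≡0 (size Δ)))
         (∑-cong (subsets (size Δ)) (λ S → swap (does (nonempty? S)) (does (face? Δ S)))) ⟨
  (if does (face? Δ ∅) then r ^ ∣ ∅ {size Δ} ∣ else 0)
    ℕ.+ (∑ (subsets (size Δ)) λ S → if does (nonempty? S) then (if does (face? Δ S) then r ^ ∣ S ∣ else 0) else 0)
    ≡⟨ ∑-subsets-nonempty (size Δ) (λ S → if does (face? Δ S) then r ^ ∣ S ∣ else 0) ⟨
  ∑ (subsets (size Δ)) (λ S → if does (face? Δ S) then r ^ ∣ S ∣ else 0) ∎
  where
  L = nonemptyFaces Δ
  P? = λ S → face? Δ S ×-dec nonempty? S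

  swap : ∀ a b {k : ℕ} → (if a then (if b then k else 0) else 0) ≡ (if b ∧ a then k else 0)
  swap true  true  = refl
  swap true  false = refl
  swap false true  = refl
  swap false false = refl

  face≡chainᵇ : ∀ σ → does (face? (barycentric Δ) σ) ≡ chainᵇ (λ _ → true) L σ
  face≡chainᵇ σ = does-⇔ (mk⇔ (chainᵇ-complete (λ _ → true) (nonemptyFaces-descending Δ) σ (λ _ _ → _))
                              (proj₂ ∘ chainᵇ-sound (λ _ → true) L σ))
                         (face? (barycentric Δ) σ) (T? (chainᵇ (λ _ → true) L σ))

∑-hVector-barycentric : ∀ r d Δ → HasDim[ d -1] Δ →
  sum (λ k → hVector d (barycentric Δ) k * fromℕ (shiftedBinomial r d (toℕ k)))
    ≡ sum (λ k → hVector d Δ k * fromℕ (mixedPower r d (toℕ k)))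
∑-hVector-barycentric r d Δ (_ , bound) = begin
  sum {suc d} (λ k → hVector d (barycentric Δ) k * fromℕ (shiftedBinomial r d (toℕ k)))
    ≡⟨ ∑-hVector-shiftedBinomial r d (barycentric Δ) ⟩
  sum {suc d} (λ i → fromℕ (faceCount (barycentric Δ) (toℕ i)) * fromℕ (r C toℕ i))
    ≡⟨ ∑-faceCount (barycentric Δ) d (r C_) (barycentric-bound Δ d bound) ⟩
  fromℕ (∑ (subsets (size (barycentric Δ))) (λ σ → if does (face? (barycentric Δ) σ) then r C ∣ σ ∣ else 0))
    ≡⟨ cong fromℕ (∑-barycentric r Δ) ⟩
  fromℕ (∑ (subsets (size Δ)) (λ S → if does (face? Δ S) then r ^ ∣ S ∣ else 0))
    ≡⟨ ∑-faceCount Δ d (r ^_) bound ⟨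
  sum {suc d} (λ i → fromℕ (faceCount Δ (toℕ i)) * fromℕ (r ^ toℕ i))
    ≡⟨ ∑-hVector-mixedPower r d Δ ⟨
  sum {suc d} (λ k → hVector d Δ k * fromℕ (mixedPower r d (toℕ k))) ∎

-- The product as a transformation matrix

x-y≡0⇒x≡y : ∀ x y → x - y ≡ 0ℚ → x ≡ y
x-y≡0⇒x≡y x y x-y≡0 = trans (solve 2 (λ x y → x := (x :- y) :+ y) refl x y) (trans (cong (_+ y) x-y≡0) (ℚ.+-identityˡ y))
  where open ℚSolver.+-*-Solver using (solve; _:=_; _:+_; _:-_)

∑-difference : ∀ {n} (u v t : Fin n → ℚ) → sum (λ k → u k * t k) ≡ sum (λ k → v k * t k) →
  sum (λ k → (u k - v k) * t k) ≡ 0ℚ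
∑-difference {n} u v t eq = begin
  sum (λ k → (u k - v k) * t k)
    ≡⟨ sum-cong-≗ (λ k → solve 3 (λ u v t → (u :- v) :* t := u :* t :+ (:- con 1ℚ) :* (v :* t)) refl (u k) (v k) (t k)) ⟩
  sum (λ k → u k * t k + (- 1ℚ) * (v k * t k))
    ≡⟨ ∑-distrib-+ (λ k → u k * t k) (λ k → (- 1ℚ) * (v k * t k)) ⟩
  sum (λ k → u k * t k) + sum (λ k → (- 1ℚ) * (v k * t k))
    ≡⟨ cong₂ _+_ eq (sym (*-distribˡ-sum (- 1ℚ) (λ k → v k * t k))) ⟩
  sum (λ k → v k * t k) + (- 1ℚ) * sum (λ k → v k * t k)
    ≡⟨ solve 1 (λ x → x :+ (:- con 1ℚ) :* x := con 0ℚ) refl (sum (λ k → v k * t k)) ⟩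
  0ℚ ∎
  where open ℚSolver.+-*-Solver using (solve; _:=_; _:+_; _:-_; :-_; _:*_; con)

-- The values `r = 0, …, d` suffice: for `r < c` the upper index `r + (d ∸ c)` is below `d` and the
-- binomial vanishes, while for `r = c` it is C(d,d) = 1.
shiftedBinomial-injective : ∀ d (u v : Fin (suc d) → ℚ) →
  (∀ r → sum (λ k → u k * fromℕ (shiftedBinomial r d (toℕ k))) ≡ sum (λ k → v k * fromℕ (shiftedBinomial r d (toℕ k)))) →
  ∀ k → u k ≡ v k
shiftedBinomial-injective d u v eq k = x-y≡0⇒x≡y (u k) (v k)
  (lowerTriangular-injective (λ r k → fromℕ (shiftedBinomial (toℕ r) d (toℕ k))) (λ k → u k - v k)
    (λ r c r<c → cong fromℕ (k>n⇒nCk≡0 (subst (toℕ r ℕ.+ (d ∸ toℕ c) <_) (ℕ.m+[n∸m]≡n (toℕ≤pred[n] c)) (ℕ.+-monoˡ-< (d ∸ toℕ c) r<c))))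
    (λ r eq0 → 1≢0 (trans (sym (cong fromℕ (trans (cong (_C d) (ℕ.m+[n∸m]≡n (toℕ≤pred[n] r))) (nCn≡1 d)))) eq0))
    (λ r → ∑-difference u v (λ k → fromℕ (shiftedBinomial (toℕ r) d (toℕ k))) (eq (toℕ r))) k)
  where
  1≢0 : fromℕ 1 ≢ 0ℚ
  1≢0 ()

W-product-isTransformationMatrix : ∀ d → IsTransformationMatrix d (product (map (W d) (upTo (2 ℕ.* d))))
W-product-isTransformationMatrix d Δ dim =
  shiftedBinomial-injective d (hVector d (barycentric Δ)) (M ⊗ᵥ hVector d Δ) λ r → begin
    sum (λ k → hVector d (barycentric Δ) k * fromℕ (shiftedBinomial r d (toℕ k)))
      ≡⟨ ∑-hVector-barycentric r d Δ dim ⟩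
    sum (λ c → hVector d Δ c * fromℕ (mixedPower r d (toℕ c)))
      ≡⟨ sum-cong-≗ (λ c → trans (ℚ.*-comm (hVector d Δ c) (fromℕ (mixedPower r d (toℕ c)))) (cong (_* hVector d Δ c) (sym (shiftedBinomial-W r d c)))) ⟩
    sum (λ c → sum (λ m → fromℕ (shiftedBinomial r d (toℕ m)) * M m c) * hVector d Δ c)
      ≡⟨ ∑-assoc {suc d} (λ m → fromℕ (shiftedBinomial r d (toℕ m))) M (hVector d Δ) ⟨
    sum {suc d} (λ m → fromℕ (shiftedBinomial r d (toℕ m)) * (M ⊗ᵥ hVector d Δ) m)
      ≡⟨ sum-cong-≗ {suc d} (λ m → ℚ.*-comm (fromℕ (shiftedBinomial r d (toℕ m))) ((M ⊗ᵥ hVector d Δ) m)) ⟩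
    sum {suc d} (λ m → (M ⊗ᵥ hVector d Δ) m * fromℕ (shiftedBinomial r d (toℕ m))) ∎
  where
  M = product (map (W d) (upTo (2 ℕ.* d)))

-- Uniqueness of the transformation matrix

-- Raising j to j + 1 only changes the number of faces with j + 1 elements.
skeletonCone : ∀ d → ℕ → Complex
skeletonCone d j = record
  { size   = suc d
  ; Face   = λ S → zero ∉ S ⊎ ∣ S ∣ ≤ j
  ; face?  = λ S → ¬? (zero ∈? S) ⊎-dec (∣ S ∣ ℕ.≤? j)
  ; ∅-face = inj₁ ∉⊥
  ; down   = λ S⊆T → Sum.map (_∘ S⊆T) (ℕ.≤-trans (p⊆q⇒∣p∣≤∣q∣ S⊆T))
  }

skeletonCone-dim : ∀ d j → j ≤ d → HasDim[ d -1] (skeletonCone d j)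
-- The largest face chosen consists of all elements other than `zero`.
skeletonCone-dim d j j≤d = (outside ∷ ⊤ , inj₁ (λ ()) , ∣⊤∣≡n d) , bound
  where
  bound : ∀ S → Face (skeletonCone d j) S → ∣ S ∣ ≤ d
  bound S             (inj₂ ∣S∣≤j) = ℕ.≤-trans ∣S∣≤j j≤d
  bound (outside ∷ S) (inj₁ _)     = ∣p∣≤n S
  bound (inside ∷ S)  (inj₁ 0∉S)   = contradiction here 0∉S

-- For `i ≤ j` all sets of size `i` are faces of both complexes; for `i > j′` only those without
-- `zero` are, again in both.
faceCount-skeletonCone-stable : ∀ d i {j j′} → j ≤ j′ → i ≤ j ⊎ j′ < i →
  faceCount (skeletonCone d j′) i ≡ faceCount (skeletonCone d j) i
faceCount-skeletonCone-stable d i {j} {j′} j≤j′ i-outside =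
  cong length (filter-≐ _ _ ((λ {S} → lower-face {S}) , (λ {S} → raise-face {S})) (subsets (suc d)))
  where
  lower-face : ∀ {S} → Face (skeletonCone d j′) S × ∣ S ∣ ≡ i → Face (skeletonCone d j) S × ∣ S ∣ ≡ i
  lower-face (inj₁ 0∉S    , ∣S∣≡i) = inj₁ 0∉S , ∣S∣≡i
  lower-face (inj₂ ∣S∣≤j′ , ∣S∣≡i) = inj₂ (small i-outside) , ∣S∣≡i
    where
    small : i ≤ j ⊎ j′ < i → _
    small (inj₁ i≤j)  = subst (_≤ j) (sym ∣S∣≡i) i≤j
    small (inj₂ j′<i) = contradiction (subst (_≤ j′) ∣S∣≡i ∣S∣≤j′) (ℕ.<⇒≱ j′<i)

  raise-face : ∀ {S} → Face (skeletonCone d j) S × ∣ S ∣ ≡ i → Face (skeletonCone d j′) S × ∣ S ∣ ≡ i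
  raise-face (face , ∣S∣≡i) = Sum.map₂ (λ ∣S∣≤j → ℕ.≤-trans ∣S∣≤j j≤j′) face , ∣S∣≡i

∈-subsets : ∀ {n} (S : Subset n) → S ∈ₗ subsets n
∈-subsets []            = here refl
∈-subsets (inside ∷ S)  = ∈-++⁺ˡ (∈-map⁺ (inside ∷_) (∈-subsets S))
∈-subsets (outside ∷ S) = ∈-++⁺ʳ _ (∈-map⁺ (outside ∷_) (∈-subsets S))

∃-subset-of-size : ∀ {n k} → k ≤ n → ∃ λ (S : Subset n) → ∣ S ∣ ≡ k
∃-subset-of-size {n}     z≤n       = ∅ , ∣⊥∣≡0 n
∃-subset-of-size {suc n} (s≤s k≤n) = let (S , ∣S∣≡k) = ∃-subset-of-size k≤n in inside ∷ S , cong suc ∣S∣≡k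

filter-filter : ∀ {A : Set} {P Q : Pred A 0ℓ} (P? : Decidable P) (Q? : Decidable Q) → (∀ {x} → P x → Q x) →
  ∀ xs → filter P? (filter Q? xs) ≡ filter P? xs
filter-filter P? Q? P⇒Q []       = refl
filter-filter P? Q? P⇒Q (x ∷ xs) with Q? x
... | no ¬q = trans (filter-filter P? Q? P⇒Q xs) (sym (filter-reject P? (¬q ∘ P⇒Q)))
... | yes _ with does (P? x)
...   | true  = cong (x ∷_) (filter-filter P? Q? P⇒Q xs)
...   | false = filter-filter P? Q? P⇒Q xs

-- Filtering by `P` can be done after filtering by `Q`, and the second pass discards `x`.
length-filter-< : ∀ {A : Set} {P Q : Pred A 0ℓ} (P? : Decidable P) (Q? : Decidable Q) → (∀ {x} → P x → Q x) →
  ∀ {x xs} → x ∈ₗ xs → Q x → ¬ P x → length (filter P? xs) < length (filter Q? xs)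
length-filter-< P? Q? P⇒Q {xs = xs} x∈xs qx ¬px =
  subst (λ ys → length ys < length (filter Q? xs)) (filter-filter P? Q? P⇒Q xs)
    (filter-notAll P? (filter Q? xs) (lose (∈-filter⁺ Q? x∈xs qx) ¬px))

-- The additional face consists of `zero` and `i` of the other `d` elements.
faceCount-skeletonCone-< : ∀ d i → i < d →
  faceCount (skeletonCone d 0) (suc i) < faceCount (skeletonCone d (suc i)) (suc i)
faceCount-skeletonCone-< d i i<d = let (S , ∣S∣≡i) = ∃-subset-of-size (ℕ.<⇒≤ i<d) in
  length-filter-< _ _ (λ {S} → raise {S}) (∈-subsets (inside ∷ S))
    (inj₂ (ℕ.≤-reflexive (cong suc ∣S∣≡i)) , cong suc ∣S∣≡i)
    λ { (inj₁ 0∉S , _) → 0∉S here ; (inj₂ () , _) }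
  where
  raise : ∀ {S} → Face (skeletonCone d 0) S × ∣ S ∣ ≡ suc i → Face (skeletonCone d (suc i)) S × ∣ S ∣ ≡ suc i
  raise (_ , ∣S∣≡1+i) = inj₂ (ℕ.≤-reflexive ∣S∣≡1+i) , ∣S∣≡1+i

faceCount-zero : ∀ Δ → faceCount Δ 0 ≢ 0
faceCount-zero Δ = ℕ.>⇒≢ (filter-some (λ S → face? Δ S ×-dec (∣ S ∣ ℕ.≟ 0)) {subsets (size Δ)} (lose (∈-subsets ∅) (∅-face Δ , ∣⊥∣≡0 (size Δ))))

-- Subtracting the relation for the cone with `j = 0` from that with `j = r + 1` leaves a triangular
-- system in the positive sizes. The coordinate of the empty face is then recovered from a single
-- complex.
faceCounts-independent : ∀ d (v : Fin (suc d) → ℚ) →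
  (∀ Δ → HasDim[ d -1] Δ → sum (λ i → fromℕ (faceCount Δ (toℕ i)) * v i) ≡ 0ℚ) → ∀ i → v i ≡ 0ℚ
faceCounts-independent d v vanish = λ where
    zero    → x*y≡0⇒x≡0 (v zero) (f 0 0) (faceCount-zero (skeletonCone d 0) ∘ fromℕ-injective) (begin
      v zero * f 0 0
        ≡⟨ ℚ.*-comm (v zero) (f 0 0) ⟩
      f 0 0 * v zero
        ≡⟨ ℚ.+-identityʳ (f 0 0 * v zero) ⟨
      f 0 0 * v zero + 0ℚ
        ≡⟨ cong (f 0 0 * v zero +_) (sum-zero d λ i → trans (cong (f 0 (suc (toℕ i)) *_) (positive i)) (ℚ.*-zeroʳ (f 0 (suc (toℕ i))))) ⟨
      sum (λ i → f 0 (toℕ i) * v i)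
        ≡⟨ vanish (skeletonCone d 0) (skeletonCone-dim d 0 z≤n) ⟩
      0ℚ ∎)
    (suc i) → positive i
  where
  f : ℕ → ℕ → ℚ
  f j i = fromℕ (faceCount (skeletonCone d j) i)

  x-x≡0 : ∀ {x y} → x ≡ y → x - y ≡ 0ℚ
  x-x≡0 {x} refl = ℚ.+-inverseʳ x

  positive : ∀ i → v (suc i) ≡ 0ℚ
  positive = lowerTriangular-injective
    (λ r c → f (suc (toℕ r)) (suc (toℕ c)) - f 0 (suc (toℕ c))) (v ∘ suc)
    (λ r c r<c → x-x≡0 (cong fromℕ (faceCount-skeletonCone-stable d (suc (toℕ c)) z≤n (inj₂ (s≤s r<c)))))
    (λ r eq → ℕ.<⇒≢ (faceCount-skeletonCone-< d (toℕ r) (toℕ<n r))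
      (sym (fromℕ-injective (x-y≡0⇒x≡y _ _ eq))))
    λ r → begin
      sum (λ c → v (suc c) * (f (suc (toℕ r)) (suc (toℕ c)) - f 0 (suc (toℕ c))))
        ≡⟨ sum-cong-≗ {d} (λ c → ℚ.*-comm (v (suc c)) (f (suc (toℕ r)) (suc (toℕ c)) - f 0 (suc (toℕ c)))) ⟩
      sum (λ c → (f (suc (toℕ r)) (suc (toℕ c)) - f 0 (suc (toℕ c))) * v (suc c))
        ≡⟨ ℚ.+-identityˡ _ ⟨
      0ℚ + sum (λ c → (f (suc (toℕ r)) (suc (toℕ c)) - f 0 (suc (toℕ c))) * v (suc c))
        -- The size-zero term cancels because the two complexes have equally many empty faces.
        ≡⟨ cong (_+ sum (λ c → (f (suc (toℕ r)) (suc (toℕ c)) - f 0 (suc (toℕ c))) * v (suc c)))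
             (trans (cong (_* v zero) (x-x≡0 (cong fromℕ (faceCount-skeletonCone-stable d 0 {j′ = suc (toℕ r)} z≤n (inj₁ z≤n)))))
                    (ℚ.*-zeroˡ (v zero))) ⟨
      sum (λ c → (f (suc (toℕ r)) (toℕ c) - f 0 (toℕ c)) * v c)
        ≡⟨ ∑-difference (λ c → f (suc (toℕ r)) (toℕ c)) (λ c → f 0 (toℕ c)) v
             (trans (vanish (skeletonCone d (suc (toℕ r))) (skeletonCone-dim d (suc (toℕ r)) (toℕ<n r)))
                    (sym (vanish (skeletonCone d 0) (skeletonCone-dim d 0 z≤n)))) ⟩
      0ℚ ∎

-- In terms of face numbers, the coefficients of the relation are the image of `v` under the
-- unitriangular matrix `p`; they vanish, and hence so does `v`.
hVectors-independent : ∀ d (v : Fin (suc d) → ℚ) →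
  (∀ Δ → HasDim[ d -1] Δ → sum (λ k → hVector d Δ k * v k) ≡ 0ℚ) → ∀ k → v k ≡ 0ℚ
hVectors-independent d v vanish = upperTriangular-injective p v
  (λ r c c<r → xᵃ[1-x]ᵇ-order (toℕ r) (d ∸ toℕ r) (toℕ c) c<r)
  (λ r eq → 1≢0 (trans (sym (xᵃ[1-x]ᵇ-lowest (toℕ r) (d ∸ toℕ r))) eq))
  (λ r → trans (sum-cong-≗ (λ c → ℚ.*-comm (v c) (p r c)))
    (faceCounts-independent d (λ i → sum (λ k → p i k * v k)) (λ Δ dim → trans (sym (∑-hVector d Δ v)) (vanish Δ dim)) r))
  where
  p : Fin (suc d) → Fin (suc d) → ℚ
  p i k = xᵃ[1-x]ᵇ (toℕ i) (d ∸ toℕ i) (toℕ k)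

  1≢0 : 1ℚ ≢ 0ℚ
  1≢0 ()

-- Every row of the difference of the two matrices annihilates all h-vectors.
IsTransformationMatrix-unique : ∀ d {H M} → IsTransformationMatrix d H → IsTransformationMatrix d M →
  ∀ r c → H r c ≡ M r c
IsTransformationMatrix-unique d {H} {M} isH isM r c = x-y≡0⇒x≡y (H r c) (M r c)
  (hVectors-independent d (λ k → H r k - M r k)
    (λ Δ dim → trans (sum-cong-≗ (λ k → ℚ.*-comm (hVector d Δ k) (H r k - M r k)))
      (∑-difference (H r) (M r) (hVector d Δ) (trans (sym (isH Δ dim r)) (isM Δ dim r)))) c)

theorem3p2 : (d : ℕ) → 1 ≤ d →
    (H : Matrix (suc d)) → IsTransformationMatrix d H →
    (r c : Fin (suc d)) → H r c ≡ product (map (W d) (upTo (2 ℕ.* d))) r c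
theorem3p2 d _ H isH = IsTransformationMatrix-unique d isH (W-product-isTransformationMatrix d)
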